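{- Let $p$ be a prime and let $\mathcal{R}_p$ be the set of quadratic residues in $\mathbb{F}_p$. Assume that $\mathcal{A},\mathcal{B}\subseteq\mathbb{F}_p$ satisfy $|\mathcal{A}|,|\mathcal{B}|\geqslant 2$ and $\mathcal{A}+\mathcal{B}=\mathcal{R}_p$. Then \[\mathfrak{A}(\mathcal{A},\mathcal{B})\geqslant (\log 2)^{ -1}\sqrt{p}-1.6.\]
   Context: $\mathcal{R}_p=\{x^2:x\in\mathbb{F}_p^\times\}$. For $\mathcal{A},\mathcal{B}\subseteq\mathbb{F}_p$, $\mathcal{A}+\mathcal{B}=\{a+b:a\in\mathcal{A},b\in\mathcal{B}\}$, the representation function is $r(x)=|\{(a,b)\in\mathcal{A}\times\mathcal{B}:a+b=x\}|$, and $\mathfrak{A}(\mathcal{A},\mathcal{B})=|\{x\in\mathcal{A}+\mathcal{B}: r(x)=1\}|$ is the number of elements of $\mathcal{A}+\mathcal{B}$ with a unique representation. -}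

module Defs where

open import Data.Bool using (Bool; true; false; _∧_)
open import Data.Nat as ℕ using (ℕ; zero; suc; NonZero; _≡ᵇ_)
open import Data.Nat.DivMod using (_%_; m%n<n)
open import Data.Fin using (Fin; toℕ; fromℕ<)
open import Data.Fin.Subset using (Subset; _∈_)
open import Data.Vec using (lookup)
open import Data.List using (List; length; filterᵇ; allFin; cartesianProduct)
open import Data.Product using (_×_; _,_; ∃; ∃-syntax)
open import Data.Integer using (+_)
open import Data.Rational as ℚ using (ℚ; _/_; _+_; _*_)
open import Relation.Binary.PropositionalEquality using (_≡_; _≢_)

module _ (p : ℕ) .{{_ : NonZero p}} where

  addF : Fin p → Fin p → Fin p
  addF a b = fromℕ< (m%n<n (toℕ a ℕ.+ toℕ b) p)

  mulF : Fin p → Fin p → Fin p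
  mulF a b = fromℕ< (m%n<n (toℕ a ℕ.* toℕ b) p)

  IsQR : Fin p → Set
  IsQR x = ∃[ y ] (toℕ y ≢ 0 × mulF y y ≡ x)

  InSumset : Subset p → Subset p → Fin p → Set
  InSumset A B x = ∃[ a ] ∃[ b ] (a ∈ A × b ∈ B × addF a b ≡ x)

  rep : Subset p → Subset p → Fin p → ℕ
  rep A B x = length (filterᵇ ok (cartesianProduct (allFin p) (allFin p)))
    where
    ok : Fin p × Fin p → Bool
    ok (a , b) = lookup A a ∧ lookup B b ∧ (toℕ (addF a b) ≡ᵇ toℕ x)

  -- 𝔄(𝓐,𝓑) = #{x ∈ 𝓐 + 𝓑 : r(x) = 1}   (r(x) = 1 already forces x ∈ 𝓐 + 𝓑)
  uniqueCount : Subset p → Subset p → ℕ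
  uniqueCount A B = length (filterᵇ (λ x → rep A B x ≡ᵇ 1) (allFin p))

-- ln 2 = Σ_{k≥1} 1/(k 2^k).  Upper approximations
--   U K = Σ_{k=1}^{K} 1/(k 2^k) + 1/((K+1) 2^K),
-- which decrease strictly to ln 2 (the tail Σ_{k>K} is < 1/((K+1)2^K)).
-- Hence for c ≥ 0 :  c ≤ ln 2 · d  (d ≥ 0)  iff  c ≤ U K · d for all K.
halfPow : ℕ → ℚ
halfPow zero = ℚ.1ℚ
halfPow (suc k) = halfPow k * ((+ 1) / 2)

lnTwoPartial : ℕ → ℚ
lnTwoPartial zero = ℚ.0ℚ
lnTwoPartial (suc k) = lnTwoPartial k + ((+ 1) / suc k) * halfPow (suc k)

lnTwoUpper : ℕ → ℚ
lnTwoUpper K = lnTwoPartial K + ((+ 1) / suc K) * halfPow K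

-- "√p ≤ (N + 1.6) · ln 2", i.e. "N ≥ (ln 2)⁻¹ √p − 1.6", for p, N ∈ ℕ.
-- Both sides are ≥ 0, so this is p ≤ ((N + 8/5) ln 2)², and since U K ↓ ln 2
-- this holds iff p ≤ ((N + 8/5) · U K)² for every K.
SqrtLeLn2Bound : ℕ → ℕ → Set
SqrtLeLn2Bound p N = ∀ (K : ℕ) → ((+ p) / 1) ℚ.≤ (c K * c K)
  where
  c : ℕ → ℚ
  c K = (((+ N) / 1) + ((+ 8) / 5)) * lnTwoUpper K

{-# OPTIONS --safe #-}
module Submission where

-- Stepanov's method in the form of Hanson and Petridis. Put d = (p - 1) / 2, m = |A|, and choose
-- weights c_a (a ∈ A) with Σ c_a a^j = 0 for j < m - 1 and Σ c_a a^(m-1) = 1. The polynomial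
-- Σ c_a (x + a)^(d+m-1) - 1 has degree d, and since (b + a)^d = 1 on A + B it vanishes to order m
-- at every b ∈ B. Hence |A| |B| ≤ d = |R_p| = |A + B|, so every element of A + B is represented
-- exactly once, the number of these is d = (p - 1) / 2, and (p - 1) / 2 ≥ √p / ln 2 - 1.6.

open import Defs
open import Data.Nat using (ℕ; NonZero; _≤_)
open import Data.Nat.Primality using (Prime)
open import Data.Fin using (Fin)
open import Data.Fin.Subset using (Subset; ∣_∣)
open import Data.Product using (_×_)

open import Algebra.Bundles using (CommutativeRing; CommutativeSemiring)
import Algebra.Properties.CommutativeMonoid.Mult as CommutativeMonoidMult
import Algebra.Properties.CommutativeMonoid.Sum as Sum
import Algebra.Properties.CommutativeSemiring.Binomial as Binomial
import Algebra.Properties.CommutativeSemiring.Exp as Exp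
import Algebra.Properties.Group as GroupProperties
import Algebra.Properties.Ring as RingProperties
import Algebra.Properties.Semiring.Mult as Mult
import Algebra.Solver.Ring.NaturalCoefficients.Default as Solver
open import Data.Bool using (Bool; true; false; _∧_)
open import Data.Bool.Properties using (T?; T-≡; T-∧)
open import Data.Fin as Fin using (toℕ; fromℕ; fromℕ<; inject₁)
import Data.Fin.Properties as Fin
import Data.Fin.Subset as Subset
open import Data.Integer as ℤ using (ℤ; +_; 0ℤ; 1ℤ)
import Data.Integer.DivMod as ℤ
open import Data.Integer.Divisibility.Signed as ℤ using (divides) renaming (_∣_ to _∣ℤ_)
import Data.Integer.Properties as ℤ
import Data.Integer.Tactic.RingSolver as ℤ
open import Data.List using (List; []; _∷_; _++_; length; lookup; map; allFin; tabulate; cartesianProduct; filterᵇ)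
open import Data.List.Membership.Propositional using (_∈_)
open import Data.List.Membership.Propositional.Properties
  using (∈-length; ∈-filter⁺; ∈-filter⁻; ∈-allFin; ∈-cartesianProduct⁺; ∈-map⁻)
open import Data.List.Properties using (length-map; map-++; map-∘; map-tabulate)
open import Data.List.Relation.Unary.All as All using (All; []; _∷_)
open import Data.List.Relation.Unary.AllPairs as AllPairs using (AllPairs; []; _∷_)
import Data.List.Relation.Unary.AllPairs.Properties as AllPairs
open import Data.List.Relation.Unary.Any using (here; index)
import Data.List.Relation.Unary.Any.Properties as Any
open import Data.List.Relation.Unary.Unique.Propositional.Properties using (allFin⁺)
open import Data.Nat as ℕ using (zero; suc; _∸_; _<_; z≤n; s≤s; _!; _≡ᵇ_; _<ᵇ_)
open import Data.Nat.Combinatorics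
  using (_C_; nCk+nC[k+1]≡[n+1]C[k+1]; k>n⇒nCk≡0; nCn≡1; nCk≡n!/k![n-k]!; k![n∸k]!∣n!)
open import Data.Nat.Divisibility as ℕ using (_∣_)
import Data.Nat.DivMod as ℕ
open import Data.Nat.ListAction using (sum)
open import Data.Nat.ListAction.Properties using (sum-++)
open import Data.Nat.Primality using (euclidsLemma; prime⇒irreducible; prime⇒nonTrivial; prime⇒nonZero)
import Data.Nat.Properties as ℕ
open import Data.Nat.Tactic.RingSolver using (solve-∀)
open import Data.Product using (_,_; ∃; ∃₂; proj₁; proj₂)
open import Data.Rational as ℚ using (ℚ; 0ℚ)
import Data.Rational.Properties as ℚ
open import Data.Rational.Unnormalised as ℚᵘ using (mkℚᵘ; *≤*)
import Data.Rational.Unnormalised.Properties as ℚᵘ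
open import Data.Sum using (_⊎_; inj₁; inj₂; [_,_]′)
import Data.Vec as Vec
open import Data.Vec.Properties using ([]=⇒lookup; lookup⇒[]=)
open import Function using (_∘_; id; Equivalence)
open import Level using (0ℓ; _⊔_)
open import Relation.Binary.PropositionalEquality as ≡ using (_≡_; _≢_)
open import Relation.Nullary using (¬_; yes; no; contradiction)
open import Relation.Nullary.Decidable using (from-yes)

-- Taylor coefficients of polynomials and Stepanov's method

-- The exponent exceeds d by m - 1 for two reasons. The Taylor coefficient of order k at y of Σ c_a
-- (x + a)^(d+m-1) is a binomial multiple of Σ c_a (y + a)^(d+m-1-k). At y = b the factor (b + a)^d
-- drops out, which leaves the moment of order m - 1 - k: it is 1 for k = 0, hence the constant -1,
-- and 0 for 0 < k < m. At y = 0 nothing drops out, but the coefficients of x^k with k > d carry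
-- moments of order below m - 1 and vanish. The leading coefficient is then the binomial coefficient
-- of d + m - 1 over d, and the obstacle is that it has to be nonzero modulo p. The moment
-- conditions survive translation of the nodes, so a single choice of weights serves every b.
-- Equality of |A| |B| and d is never formed: summing 2 [r(x) > 0] ≤ [r(x) = 1] + r(x) over x gives
-- 2d ≤ 𝔄(A, B) + |A| |B| directly.

NonzeroInvertible : ∀ {c ℓ} → CommutativeRing c ℓ → Set (c ⊔ ℓ)
NonzeroInvertible R = ∀ x → x ≉ 0# → ∃ λ y → y * x ≈ 1#
  where open CommutativeRing R

module Stepanov {c ℓ} (R : CommutativeRing c ℓ) (inverse : NonzeroInvertible R) where

  open CommutativeRing R hiding (zero)
  open GroupProperties +-group using (x∙y⁻¹≈ε⇒x≈y; x≈y⇒x∙y⁻¹≈ε; ∙-cancelʳ)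
  open RingProperties ring using ([y-z]x≈yx-zx)
  open Exp commutativeSemiring using (_^_; ^-congʳ; ^-homo-*)
  open CommutativeMonoidMult +-commutativeMonoid using () renaming (×-distrib-+ to ·-distrib-+)
  open Mult semiring using (×-congˡ; ×-congʳ; ×-comm-*; ×-homo-+) renaming (_×_ to _·_)
  open Solver commutativeSemiring using (solve; _:=_; _:+_; _:*_; con)
  open import Relation.Binary.Reasoning.Setoid setoid

  cancel-nonzero : ∀ {x y} → x ≉ 0# → x * y ≈ 0# → y ≈ 0#
  cancel-nonzero {x} {y} x≉0 xy≈0 with u , ux≈1 ← inverse x x≉0 = begin
    y            ≈⟨ *-identityˡ y ⟨
    1# * y       ≈⟨ *-congʳ ux≈1 ⟨
    u * x * y    ≈⟨ *-assoc u x y ⟩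
    u * (x * y)  ≈⟨ *-congˡ xy≈0 ⟩
    u * 0#       ≈⟨ zeroʳ u ⟩
    0#           ∎

  cancel-distinct : ∀ {x y z} → x ≉ y → x * z ≈ y * z → z ≈ 0#
  cancel-distinct {x} {y} {z} x≉y xz≈yz =
    cancel-nonzero (x≉y ∘ x∙y⁻¹≈ε⇒x≈y x y)
      (trans ([y-z]x≈yx-zx z x y) (x≈y⇒x∙y⁻¹≈ε xz≈yz))

  -- Taylor expansions and division by a linear factor

  Poly : Set c
  Poly = List Carrier

  -- hasse k f y is the coefficient of (x - y)^k in the Taylor expansion of f at y;
  -- at y = 0 these are the coefficients of f.
  hasse : ℕ → Poly → Carrier → Carrier
  hasse k       []      y = 0#
  hasse zero    (a ∷ f) y = a + y * hasse zero f y
  hasse (suc k) (a ∷ f) y = y * hasse (suc k) f y + hasse k f y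

  hasse-≥length : ∀ k f y → length f ≤ k → hasse k f y ≈ 0#
  hasse-≥length k       []      y _        = refl
  hasse-≥length (suc k) (a ∷ f) y (s≤s f≤k) = begin
    y * hasse (suc k) f y + hasse k f y
      ≈⟨ +-cong (*-congˡ (hasse-≥length (suc k) f y (ℕ.m≤n⇒m≤1+n f≤k))) (hasse-≥length k f y f≤k) ⟩
    y * 0# + 0#                          ≈⟨ solve 1 (λ y → y :* con 0 :+ con 0 := con 0) refl y ⟩
    0#                                   ∎

  -- Taylor coefficients replace iterated derivatives, so that no factor k! has to be cancelled in
  -- positive characteristic.
  Vanishes : ℕ → Poly → Carrier → Set ℓ
  Vanishes m f y = ∀ k → k < m → hasse k f y ≈ 0#

  -- Coefficient lists may end in zeros, and the auxiliary polynomial below has a longer list than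
  -- its degree suggests; hence the degree is read off the coefficients.
  Degree : ℕ → Poly → Set ℓ
  Degree d f = hasse d f 0# ≉ 0# × (∀ k → d < k → hasse k f 0# ≈ 0#)

  -- f = f(b) + (x - b) · quot b f
  quot : Carrier → Poly → Poly
  quot b []      = []
  quot b (a ∷ f) = hasse 0 f b ∷ quot b f

  -- The division identity evaluated at `y`, with the negative terms moved across so that a semiring
  -- solver can treat it.
  hasse-quot-zero : ∀ b f y →
    hasse 0 f y + b * hasse 0 (quot b f) y ≈ hasse 0 f b + y * hasse 0 (quot b f) y
  hasse-quot-zero b []      y = solve 2 (λ b y → con 0 :+ b :* con 0 := con 0 :+ y :* con 0) refl b y
  hasse-quot-zero b (a ∷ f) y = begin
    a + y * F + b * (Fb + y * Q)    ≈⟨ solve 6 (λ a b y F Fb Q →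
        a :+ y :* F :+ b :* (Fb :+ y :* Q) := a :+ b :* Fb :+ y :* (F :+ b :* Q))
            refl a b y F Fb Q ⟩
    a + b * Fb + y * (F + b * Q)    ≈⟨ +-congˡ (*-congˡ (hasse-quot-zero b f y)) ⟩
    a + b * Fb + y * (Fb + y * Q)   ∎
    where
    F  = hasse 0 f y
    Fb = hasse 0 f b
    Q  = hasse 0 (quot b f) y

  -- Since x - b = (x - y) + (y - b), multiplication by x - b mixes two neighbouring Taylor
  -- coefficients at `y`; again written without subtraction.
  hasse-quot-suc : ∀ k b f y →
    hasse (suc k) f y + b * hasse (suc k) (quot b f) y ≈ y * hasse (suc k) (quot b f) y + hasse k (quot b f) y
  hasse-quot-suc k b [] y =
    solve 2 (λ b y → con 0 :+ b :* con 0 := y :* con 0 :+ con 0) refl b y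
  hasse-quot-suc zero b (a ∷ f) y = begin
    y * F₁ + F + b * (y * Q₁ + Q)          ≈⟨ solve 6 (λ y F F₁ b Q Q₁ →
        y :* F₁ :+ F :+ b :* (y :* Q₁ :+ Q) := y :* (F₁ :+ b :* Q₁) :+ (F :+ b :* Q))
            refl y F F₁ b Q Q₁ ⟩
    y * (F₁ + b * Q₁) + (F + b * Q)
      ≈⟨ +-cong (*-congˡ (hasse-quot-suc 0 b f y)) (hasse-quot-zero b f y) ⟩
    y * (y * Q₁ + Q) + (hasse 0 f b + y * Q) ∎
    where
    F  = hasse 0 f y
    F₁ = hasse 1 f y
    Q  = hasse 0 (quot b f) y
    Q₁ = hasse 1 (quot b f) y
  hasse-quot-suc (suc k) b (a ∷ f) y = begin
    y * F₂ + F₁ + b * (y * Q₂ + Q₁)         ≈⟨ solve 6 (λ y F F₁ b Q Q₁ →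
        y :* F₁ :+ F :+ b :* (y :* Q₁ :+ Q) := y :* (F₁ :+ b :* Q₁) :+ (F :+ b :* Q))
            refl y F₁ F₂ b Q₁ Q₂ ⟩
    y * (F₂ + b * Q₂) + (F₁ + b * Q₁)
      ≈⟨ +-cong (*-congˡ (hasse-quot-suc (suc k) b f y)) (hasse-quot-suc k b f y) ⟩
    y * (y * Q₂ + Q₁) + (y * Q₁ + Q)        ∎
    where
    F₁ = hasse (suc k) f y
    F₂ = hasse (suc (suc k)) f y
    Q  = hasse k (quot b f) y
    Q₁ = hasse (suc k) (quot b f) y
    Q₂ = hasse (suc (suc k)) (quot b f) y

  -- At `y = b` the multiples of `b` cancel, and division by x - b shifts the Taylor expansion by
  -- one place.
  hasse-quot-root : ∀ k b f → hasse (suc k) f b ≈ hasse k (quot b f) b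
  hasse-quot-root k b f = ∙-cancelʳ (b * hasse (suc k) (quot b f) b) _ _
    (trans (hasse-quot-suc k b f b) (+-comm _ _))

  vanishes-quot-root : ∀ {m b} f → Vanishes (suc m) f b → Vanishes m (quot b f) b
  vanishes-quot-root {b = b} f van k k<m =
    trans (sym (hasse-quot-root k b f)) (van (suc k) (s≤s k<m))

  -- The factor x - b has the nonzero constant term y - b in its expansion at `y`, so the
  -- coefficients of the quotient vanish one after another, each forced by its predecessor.
  vanishes-quot-other : ∀ {m b y} f → b ≉ y → hasse 0 f b ≈ 0# → Vanishes m f y → Vanishes m (quot b f) y
  vanishes-quot-other {m} {b} {y} f b≉y fb≈0 van zero 0<m = cancel-distinct b≉y (begin
    b * Q                ≈⟨ +-identityˡ _ ⟨
    0# + b * Q           ≈⟨ +-congʳ (van 0 0<m) ⟨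
    hasse 0 f y + b * Q  ≈⟨ hasse-quot-zero b f y ⟩
    hasse 0 f b + y * Q  ≈⟨ +-congʳ fb≈0 ⟩
    0# + y * Q           ≈⟨ +-identityˡ _ ⟩
    y * Q                ∎)
    where Q = hasse 0 (quot b f) y
  vanishes-quot-other {m} {b} {y} f b≉y fb≈0 van (suc k) k<m = cancel-distinct b≉y (begin
    b * Q                             ≈⟨ +-identityˡ _ ⟨
    0# + b * Q                        ≈⟨ +-congʳ (van (suc k) k<m) ⟨
    hasse (suc k) f y + b * Q         ≈⟨ hasse-quot-suc k b f y ⟩
    y * Q + hasse k (quot b f) y      ≈⟨ +-congˡ (vanishes-quot-other f b≉y fb≈0 van k (ℕ.<⇒≤ k<m)) ⟩
    y * Q + 0#                        ≈⟨ +-identityʳ _ ⟩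
    y * Q                             ∎)
    where Q = hasse (suc k) (quot b f) y

  coefficient-quot : ∀ k b f → hasse k (quot b f) 0# ≈ hasse (suc k) f 0# + b * hasse (suc k) (quot b f) 0#
  coefficient-quot k b f = sym (trans (hasse-quot-suc k b f 0#)
    (solve 2 (λ u v → con 0 :* u :+ v := v) refl _ _))

  -- Descending induction on k, from the length of the quotient (at most k + n).
  coefficient-quot-zero : ∀ {d} b f → (∀ k → d < k → hasse k f 0# ≈ 0#) →
    ∀ n k → length (quot b f) ≤ k ℕ.+ n → d ≤ k → hasse k (quot b f) 0# ≈ 0#
  coefficient-quot-zero b f high zero k len d≤k =
    hasse-≥length k (quot b f) 0# (≡.subst (length (quot b f) ≤_) (ℕ.+-identityʳ k) len)
  coefficient-quot-zero b f high (suc n) k len d≤k = begin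
    hasse k (quot b f) 0#                                       ≈⟨ coefficient-quot k b f ⟩
    hasse (suc k) f 0# + b * hasse (suc k) (quot b f) 0#        ≈⟨ +-cong (high (suc k) (s≤s d≤k)) (*-congˡ
      (coefficient-quot-zero b f high n (suc k) (≡.subst (length (quot b f) ≤_) (ℕ.+-suc k n) len) (ℕ.m≤n⇒m≤1+n d≤k))) ⟩
    0# + b * 0#
      ≈⟨ solve 1 (λ b → con 0 :+ b :* con 0 := con 0) refl b ⟩
    0#                                                          ∎

  degree-quot : ∀ {d b} f → hasse 0 f b ≈ 0# → Degree d f → ∃ λ e → d ≡ suc e × Degree e (quot b f)
  degree-quot {d} {b} f fb≈0 (lead , high) = go d lead high
    where
    vanish : ∀ {d} → (∀ k → d < k → hasse k f 0# ≈ 0#) → ∀ k → d ≤ k → hasse k (quot b f) 0# ≈ 0#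
    vanish high k = coefficient-quot-zero b f high (length (quot b f)) k (ℕ.m≤n+m _ k)
    go : ∀ d → hasse d f 0# ≉ 0# → (∀ k → d < k → hasse k f 0# ≈ 0#) → ∃ λ e → d ≡ suc e × Degree e (quot b f)
    -- A constant with a root: all coefficients of the quotient vanish, so f(0) = f(b) = 0 against
    -- `lead`.
    go zero lead high = contradiction (begin
      hasse 0 f 0#                                ≈⟨ +-identityʳ _ ⟨
      hasse 0 f 0# + 0#                           ≈⟨ +-congˡ (trans (*-congˡ (vanish high 0 z≤n)) (zeroʳ b)) ⟨
      hasse 0 f 0# + b * hasse 0 (quot b f) 0#    ≈⟨ hasse-quot-zero b f 0# ⟩
      hasse 0 f b + 0# * hasse 0 (quot b f) 0#    ≈⟨ +-cong fb≈0 (zeroˡ _) ⟩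
      0# + 0#                                     ≈⟨ +-identityˡ 0# ⟩
      0#                                          ∎) lead
    go (suc e) lead high = e , ≡.refl , lead ∘ trans (sym same) , high′
      where
      same : hasse e (quot b f) 0# ≈ hasse (suc e) f 0#
      same = begin
        hasse e (quot b f) 0#                                   ≈⟨ coefficient-quot e b f ⟩
        hasse (suc e) f 0# + b * hasse (suc e) (quot b f) 0#
          ≈⟨ +-congˡ (*-congˡ (vanish high (suc e) ℕ.≤-refl)) ⟩
        hasse (suc e) f 0# + b * 0#
          ≈⟨ solve 2 (λ u b → u :+ b :* con 0 := u) refl _ b ⟩
        hasse (suc e) f 0#                                      ∎
      high′ : ∀ k → e < k → hasse k (quot b f) 0# ≈ 0#
      high′ k e<k = vanish high k e<k

  -- Here `g` is f / (x - b)^m. The last component keeps the multiplicities at the remaining points,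
  -- which lets `roots-bound` continue with `g`.
  divide-root : ∀ {d b} m f → Vanishes m f b → Degree d f →
    ∃₂ λ e g → d ≡ m ℕ.+ e × Degree e g × (∀ {n y} → b ≉ y → Vanishes n f y → Vanishes n g y)
  divide-root zero    f van deg = _ , f , ≡.refl , deg , λ _ v → v
  divide-root (suc m) f van deg
    with e , ≡.refl , deg₁ ← degree-quot f (van 0 (s≤s z≤n)) deg
    with e′ , g , ≡.refl , deg₂ , keep ← divide-root m (quot _ f) (vanishes-quot-root f van) deg₁
    = e′ , g , ≡.refl , deg₂ , λ b≉y v → keep b≉y (vanishes-quot-other f b≉y (van 0 (s≤s z≤n)) v)

  roots-bound : ∀ {d m} f bs → AllPairs _≉_ bs → All (Vanishes m f) bs → Degree d f → length bs ℕ.* m ≤ d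
  roots-bound f []       _               _            _   = z≤n
  roots-bound {m = m} f (b ∷ bs) (b≉bs ∷ distinct) (van ∷ vans) deg
    with e , g , ≡.refl , deg′ , keep ← divide-root m f van deg
    = ℕ.+-monoʳ-≤ m (roots-bound g bs distinct
        (All.zipWith (λ (b≉y , v) → keep b≉y v) (b≉bs , vans)) deg′)

  -- Powers of linear polynomials

  infixl 6 _⊕_
  infixl 7 _⊙_

  _⊕_ : Poly → Poly → Poly
  []      ⊕ g       = g
  (a ∷ f) ⊕ []      = a ∷ f
  (a ∷ f) ⊕ (b ∷ g) = a + b ∷ f ⊕ g

  _⊙_ : Carrier → Poly → Poly
  a ⊙ f = map (a *_) f

  hasse-⊕ : ∀ k f g y → hasse k (f ⊕ g) y ≈ hasse k f y + hasse k g y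
  hasse-⊕ k       []      g       y = sym (+-identityˡ _)
  hasse-⊕ k       (a ∷ f) []      y = sym (+-identityʳ _)
  hasse-⊕ zero    (a ∷ f) (b ∷ g) y = trans (+-congˡ (*-congˡ (hasse-⊕ 0 f g y)))
    (solve 5 (λ a b y F G → a :+ b :+ y :* (F :+ G) := (a :+ y :* F) :+ (b :+ y :* G)) refl _ _ _ _ _)
  hasse-⊕ (suc k) (a ∷ f) (b ∷ g) y = trans (+-cong (*-congˡ (hasse-⊕ (suc k) f g y)) (hasse-⊕ k f g y))
    (solve 5 (λ y F F′ G G′ → y :* (F′ :+ G′) :+ (F :+ G) := (y :* F′ :+ F) :+ (y :* G′ :+ G)) refl _ _ _ _ _)

  hasse-⊙ : ∀ k a f y → hasse k (a ⊙ f) y ≈ a * hasse k f y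
  hasse-⊙ k       a []      y = sym (zeroʳ a)
  hasse-⊙ zero    a (b ∷ f) y = trans (+-congˡ (*-congˡ (hasse-⊙ 0 a f y)))
    (solve 4 (λ a b y F → a :* b :+ y :* (a :* F) := a :* (b :+ y :* F)) refl _ _ _ _)
  hasse-⊙ (suc k) a (b ∷ f) y = trans (+-cong (*-congˡ (hasse-⊙ (suc k) a f y)) (hasse-⊙ k a f y))
    (solve 4 (λ a y F F′ → y :* (a :* F′) :+ a :* F := a :* (y :* F′ :+ F)) refl _ _ _ _)

  linearPower : Carrier → ℕ → Poly
  linearPower a zero    = 1# ∷ []
  linearPower a (suc n) = a ⊙ linearPower a n ⊕ (0# ∷ linearPower a n)

  ·-zero : ∀ n → n · 0# ≈ 0#
  ·-zero zero    = refl
  ·-zero (suc n) = trans (+-identityˡ _) (·-zero n)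

  ·-vanish : ∀ {n} x → n ≡ 0 → n · x ≈ 0#
  ·-vanish x n≡0 = ×-congˡ n≡0

  -- For k ≥ n both truncated exponents are 0 and the powers of `x` no longer match; there the
  -- binomial coefficient is zero.
  C-power-suc : ∀ n k x → x * ((n C suc k) · x ^ (n ∸ suc k)) ≈ (n C suc k) · x ^ (n ∸ k)
  C-power-suc n k x with suc k ℕ.≤? n
  ... | yes k<n = begin
    x * ((n C suc k) · x ^ (n ∸ suc k))  ≈⟨ ×-comm-* (n C suc k) x _ ⟩
    (n C suc k) · x ^ suc (n ∸ suc k)    ≈⟨ ×-congʳ (n C suc k) (^-congʳ x (≡.sym (ℕ.+-∸-assoc 1 k<n))) ⟩
    (n C suc k) · x ^ (n ∸ k)            ∎
  ... | no k≮n = begin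
    x * ((n C suc k) · x ^ (n ∸ suc k))  ≈⟨ *-congˡ (·-vanish _ C≡0) ⟩
    x * 0#                               ≈⟨ zeroʳ x ⟩
    0#                                   ≈⟨ ·-vanish _ C≡0 ⟨
    (n C suc k) · x ^ (n ∸ k)            ∎
    where C≡0 = k>n⇒nCk≡0 (ℕ.≰⇒> k≮n)

  -- Expanding x + a = (x - y) + (y + a) turns the recursion of `linearPower` into Pascal's rule.
  hasse-linearPower : ∀ k a n y → hasse k (linearPower a n) y ≈ (n C k) · (y + a) ^ (n ∸ k)
  hasse-linearPower zero a zero y = +-congˡ (zeroʳ y)
  hasse-linearPower (suc k) a zero y = trans (+-identityʳ _) (zeroʳ y)
  hasse-linearPower zero a (suc n) y = begin
    hasse 0 (linearPower a (suc n)) y  ≈⟨ hasse-⊕ 0 (a ⊙ linearPower a n) _ y ⟩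
    hasse 0 (a ⊙ linearPower a n) y + (0# + y * hasse 0 (linearPower a n) y)
      ≈⟨ +-congʳ (hasse-⊙ 0 a (linearPower a n) y) ⟩
    a * H + (0# + y * H)  ≈⟨ solve 3 (λ a y H → a :* H :+ (con 0 :+ y :* H) := (y :+ a) :* H) refl a y H ⟩
    (y + a) * H ≈⟨ *-congˡ (trans (hasse-linearPower 0 a n y) (+-identityʳ _)) ⟩
    (y + a) * (y + a) ^ n ≈⟨ +-identityʳ _ ⟨
    1 · (y + a) ^ suc n ∎
    where H = hasse 0 (linearPower a n) y
  hasse-linearPower (suc k) a (suc n) y = begin
    hasse (suc k) (linearPower a (suc n)) y  ≈⟨ hasse-⊕ (suc k) (a ⊙ linearPower a n) _ y ⟩
    hasse (suc k) (a ⊙ linearPower a n) y + (y * H′ + H) ≈⟨ +-congʳ (hasse-⊙ (suc k) a (linearPower a n) y) ⟩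
    a * H′ + (y * H′ + H)
      ≈⟨ solve 4 (λ a y H H′ → a :* H′ :+ (y :* H′ :+ H) := H :+ (y :+ a) :* H′) refl a y H H′ ⟩
    H + (y + a) * H′
      ≈⟨ +-cong (hasse-linearPower k a n y) (trans (*-congˡ (hasse-linearPower (suc k) a n y)) (C-power-suc n k (y + a))) ⟩
    (n C k) · (y + a) ^ (n ∸ k) + (n C suc k) · (y + a) ^ (n ∸ k) ≈⟨ ×-homo-+ _ (n C k) (n C suc k) ⟨
    (n C k ℕ.+ n C suc k) · (y + a) ^ (n ∸ k) ≈⟨ ×-congˡ (nCk+nC[k+1]≡[n+1]C[k+1] n k) ⟩
    (suc n C suc k) · (y + a) ^ (n ∸ k) ∎
    where
    H  = hasse k (linearPower a n) y
    H′ = hasse (suc k) (linearPower a n) y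

  -- Weighted power sums and divided differences

  Weights : Set c
  Weights = List (Carrier × Carrier)

  nodes : Weights → List Carrier
  nodes = map proj₂

  -- The shift `y` is built in because the Taylor coefficients at `y` of a combination are moments
  -- of the nodes translated by `y`.
  moment : Weights → ℕ → Carrier → Carrier
  moment []             j y = 0#
  moment ((w , a) ∷ ws) j y = w * (y + a) ^ j + moment ws j y

  combination : Weights → ℕ → Poly
  combination []             n = []
  combination ((w , a) ∷ ws) n = w ⊙ linearPower a n ⊕ combination ws n

  hasse-combination : ∀ k ws n y → hasse k (combination ws n) y ≈ (n C k) · moment ws (n ∸ k) y
  hasse-combination k [] n y = sym (·-zero (n C k))
  hasse-combination k ((w , a) ∷ ws) n y = begin
    hasse k (w ⊙ linearPower a n ⊕ combination ws n) y ≈⟨ hasse-⊕ k (w ⊙ linearPower a n) _ y ⟩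
    hasse k (w ⊙ linearPower a n) y + hasse k (combination ws n) y
      ≈⟨ +-cong (trans (hasse-⊙ k w (linearPower a n) y) (*-congˡ (hasse-linearPower k a n y))) (hasse-combination k ws n y) ⟩
    w * (N · P) + N · moment ws (n ∸ k) y ≈⟨ +-congʳ (×-comm-* N w P) ⟩
    N · (w * P) + N · moment ws (n ∸ k) y ≈⟨ ·-distrib-+ _ _ N ⟨
    N · (w * P + moment ws (n ∸ k) y) ∎
    where
    N = n C k
    P = (y + a) ^ (n ∸ k)

  -- Each weight is divided by `a - a₀`. This is also (y + a) - (y + a₀), whatever `y` is, so the
  -- recurrence holds for all translates at once.
  divide-weights : ∀ a₀ ws → All (a₀ ≉_) (nodes ws) → ∃ λ ws′ → nodes ws′ ≡ nodes ws ×
    (∀ j y → moment ws′ (suc j) y ≈ (y + a₀) * moment ws′ j y + moment ws j y)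
  divide-weights a₀ [] [] = [] , ≡.refl , λ j y →
    solve 1 (λ z → con 0 := z :* con 0 :+ con 0) refl (y + a₀)
  divide-weights a₀ ((w , a) ∷ ws) (a₀≉a ∷ a₀≉ws)
    with ws′ , same , rec ← divide-weights a₀ ws a₀≉ws
    with u , uδ≈1 ← inverse (a - a₀) (λ δ≈0 → a₀≉a (sym (x∙y⁻¹≈ε⇒x≈y a a₀ δ≈0)))
    = (w * u , a) ∷ ws′ , ≡.cong (a ∷_) same , rec′
    where
    δ = a - a₀
    a₀+δ : a₀ + δ ≈ a
    a₀+δ = trans (+-comm a₀ δ) (trans (+-assoc a (- a₀) a₀) (trans (+-congˡ (-‿inverseˡ a₀)) (+-identityʳ a)))
    rec′ : ∀ j y → moment ((w * u , a) ∷ ws′) (suc j) y ≈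
      (y + a₀) * moment ((w * u , a) ∷ ws′) j y + moment ((w , a) ∷ ws) j y
    rec′ j y = begin
      w * u * ((y + a) * P) + moment ws′ (suc j) y
        ≈⟨ +-cong (*-congˡ (*-congʳ (+-congˡ (sym a₀+δ)))) (rec j y) ⟩
      w * u * ((y + (a₀ + δ)) * P) + ((y + a₀) * M′ + M) ≈⟨
        solve 8 (λ w u y a₀ δ P M′ M →
          w :* u :* ((y :+ (a₀ :+ δ)) :* P) :+ ((y :+ a₀) :* M′ :+ M) :=
          (y :+ a₀) :* (w :* u :* P :+ M′) :+ (w :* (u :* δ) :* P :+ M)) refl w u y a₀ δ P M′ M ⟩
      (y + a₀) * (w * u * P + M′) + (w * (u * δ) * P + M) ≈⟨
        +-congˡ (+-congʳ (*-congʳ (trans (*-congˡ uδ≈1) (*-identityʳ w)))) ⟩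
      (y + a₀) * (w * u * P + M′) + (w * P + M) ∎
      where
      P  = (y + a) ^ j
      M  = moment ws j y
      M′ = moment ws′ j y

  moment-zero : ∀ ws y z → moment ws 0 y ≡ moment ws 0 z
  moment-zero []             y z = ≡.refl
  moment-zero ((w , a) ∷ ws) y z = ≡.cong (λ m → w * 1# + m) (moment-zero ws y z)

  -- The weights of the divided difference at the nodes a ∷ as. They depend only on the
  -- differences of the nodes, hence serve all translates by y at once.
  divided-difference : ∀ a as → AllPairs _≉_ (a ∷ as) → ∃ λ ws → nodes ws ≡ a ∷ as ×
    (∀ j y → j < length as → moment ws j y ≈ 0#) × (∀ y → moment ws (length as) y ≈ 1#)
  divided-difference a [] _ = (1# , a) ∷ [] , ≡.refl , (λ _ _ ()) ,
    λ y → trans (+-identityʳ _) (*-identityˡ 1#)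
  divided-difference a₀ (a ∷ as) (a₀≉as ∷ distinct)
    with ws , same , low , top ← divided-difference a as distinct
    with ws′ , same′ , rec ← divide-weights a₀ ws (≡.subst (All (a₀ ≉_)) (≡.sym same) a₀≉as)
    = ws″ , ≡.cong (a₀ ∷_) (≡.trans same′ same) , low″ , λ y → trans (rec″ _ y) (begin
        (y + a₀) * moment ws″ (length as) y + moment ws (length as) y
          ≈⟨ +-cong (*-congˡ (low″ _ y ℕ.≤-refl)) (top y) ⟩
        (y + a₀) * 0# + 1#  ≈⟨ solve 1 (λ z → z :* con 0 :+ con 1 := con 1) refl _ ⟩
        1# ∎)
    where
    -- The recurrence holds for any weight at the new node `a₀`; this one makes the moment of order
    -- 0 vanish. That moment does not depend on `y`, so evaluating it at `0#` is enough.
    w₀ = - moment ws′ 0 0#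
    ws″ = (w₀ , a₀) ∷ ws′
    rec″ : ∀ j y → moment ws″ (suc j) y ≈ (y + a₀) * moment ws″ j y + moment ws j y
    rec″ j y = trans (+-congˡ (rec j y))
      (solve 5 (λ w z P M′ M → w :* (z :* P) :+ (z :* M′ :+ M) := z :* (w :* P :+ M′) :+ M) refl _ _ _ _ _)
    low″ : ∀ j y → j < suc (length as) → moment ws″ j y ≈ 0#
    low″ zero y _ = begin
      w₀ * 1# + moment ws′ 0 y  ≈⟨ +-cong (*-identityʳ w₀) (reflexive (moment-zero ws′ y 0#)) ⟩
      w₀ + moment ws′ 0 0#      ≈⟨ -‿inverseˡ _ ⟩
      0#                        ∎
    low″ (suc j) y (s≤s j<as) = begin
      moment ws″ (suc j) y                       ≈⟨ rec″ j y ⟩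
      (y + a₀) * moment ws″ j y + moment ws j y
        ≈⟨ +-cong (*-congˡ (low″ j y (ℕ.m≤n⇒m≤1+n j<as))) (low j y j<as) ⟩
      (y + a₀) * 0# + 0#                         ≈⟨ solve 1 (λ z → z :* con 0 :+ con 0 := con 0) refl _ ⟩
      0#                                         ∎

  moment-+ : ∀ {d b} ws j → All (λ a → (b + a) ^ d ≈ 1#) (nodes ws) → moment ws (d ℕ.+ j) b ≈ moment ws j b
  moment-+ []             j []              = refl
  moment-+ {d} {b} ((w , a) ∷ ws) j (one ∷ ones) = +-cong (*-congˡ (begin
    (b + a) ^ (d ℕ.+ j)      ≈⟨ ^-homo-* (b + a) d j ⟩
    (b + a) ^ d * (b + a) ^ j ≈⟨ *-congʳ one ⟩
    1# * (b + a) ^ j         ≈⟨ *-identityˡ _ ⟩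
    (b + a) ^ j              ∎)) (moment-+ ws j ones)

  -- The auxiliary polynomial and its zeros

  sumset-in-roots-of-unity : ∀ {d} a as bs → 0 < d → AllPairs _≉_ (a ∷ as) → AllPairs _≉_ bs →
    All (λ b → All (λ a → (b + a) ^ d ≈ 1#) (a ∷ as)) bs →
    ((d ℕ.+ length as) C d) · 1# ≉ 0# → length bs ℕ.* suc (length as) ≤ d
  sumset-in-roots-of-unity {d} a as bs 0<d distinct distinct′ ones C≉0
    with ws , same , low , top ← divided-difference a as distinct
    = roots-bound f bs distinct′
        (All.map (λ one → vanish (≡.subst (All _) (≡.sym same) one)) ones) (lead , high)
    where
    l = length as
    n = d ℕ.+ l
    f = combination ws n ⊕ (- 1# ∷ [])

    hasse-f-suc : ∀ k y → hasse (suc k) f y ≈ (n C suc k) · moment ws (n ∸ suc k) y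
    hasse-f-suc k y = begin
      hasse (suc k) f y ≈⟨ hasse-⊕ (suc k) (combination ws n) _ y ⟩
      hasse (suc k) (combination ws n) y + (y * 0# + 0#)
        ≈⟨ solve 2 (λ h y → h :+ (y :* con 0 :+ con 0) := h) refl _ y ⟩
      hasse (suc k) (combination ws n) y ≈⟨ hasse-combination (suc k) ws n y ⟩
      (n C suc k) · moment ws (n ∸ suc k) y ∎

    vanish : ∀ {b} → All (λ a → (b + a) ^ d ≈ 1#) (nodes ws) → Vanishes (suc l) f b
    vanish {b} one zero _ = begin
      hasse 0 f b ≈⟨ hasse-⊕ 0 (combination ws n) _ b ⟩
      hasse 0 (combination ws n) b + (- 1# + b * 0#)
        ≈⟨ +-cong (hasse-combination 0 ws n b) (trans (+-congˡ (zeroʳ b)) (+-identityʳ _)) ⟩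
      1 · moment ws n b - 1# ≈⟨ +-congʳ (trans (+-identityʳ _) (trans (moment-+ ws l one) (top b))) ⟩
      1# - 1# ≈⟨ -‿inverseʳ 1# ⟩
      0# ∎
    -- Reducing by `d` leaves the moment of order l - (k + 1) < l, which is zero.
    vanish {b} one (suc k) (s≤s k<l) = begin
      hasse (suc k) f b ≈⟨ hasse-f-suc k b ⟩
      (n C suc k) · moment ws (n ∸ suc k) b
        ≡⟨ ≡.cong (λ j → (n C suc k) · moment ws j b) (ℕ.+-∸-assoc d k<l) ⟩
      (n C suc k) · moment ws (d ℕ.+ (l ∸ suc k)) b ≈⟨ ×-congʳ (n C suc k) (moment-+ ws (l ∸ suc k) one) ⟩
      (n C suc k) · moment ws (l ∸ suc k) b ≈⟨ ×-congʳ (n C suc k) (low _ b (ℕ.∸-monoʳ-< (s≤s z≤n) k<l)) ⟩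
      (n C suc k) · 0# ≈⟨ ·-zero (n C suc k) ⟩
      0# ∎

    -- The added constant `- 1#` affects only the coefficient of order 0; `0<d` keeps the leading
    -- coefficient clear of it.
    coefficient : ∀ k → 0 < k → hasse k f 0# ≈ (n C k) · moment ws (n ∸ k) 0#
    coefficient (suc k) _ = hasse-f-suc k 0#

    lead : hasse d f 0# ≉ 0#
    lead lead≈0 = C≉0 (begin
      (n C d) · 1# ≈⟨ ×-congʳ (n C d) (top 0#) ⟨
      (n C d) · moment ws l 0# ≡⟨ ≡.cong (λ j → (n C d) · moment ws j 0#) (ℕ.m+n∸m≡n d l) ⟨
      (n C d) · moment ws (n ∸ d) 0# ≈⟨ coefficient d 0<d ⟨
      hasse d f 0# ≈⟨ lead≈0 ⟩
      0# ∎)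

    high : ∀ k → d < k → hasse k f 0# ≈ 0#
    high k d<k with k ℕ.≤? n
    -- Above `n` the truncated exponent n ∸ k is 0, so the vanishing comes from the binomial
    -- coefficient; up to `n` it comes from the moment, whose order n - k is below `l`.
    ... | no k≰n = trans (coefficient k (ℕ.<-trans 0<d d<k)) (·-vanish _ (k>n⇒nCk≡0 (ℕ.≰⇒> k≰n)))
    ... | yes k≤n = begin
      hasse k f 0# ≈⟨ coefficient k (ℕ.<-trans 0<d d<k) ⟩
      (n C k) · moment ws (n ∸ k) 0#
        ≈⟨ ×-congʳ (n C k) (low _ 0# (≡.subst (n ∸ k <_) (ℕ.m+n∸m≡n d l) (ℕ.∸-monoʳ-< d<k k≤n))) ⟩
      (n C k) · 0# ≈⟨ ·-zero (n C k) ⟩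
      0# ∎

-- Residues modulo a prime

module _ {c ℓ} (S : CommutativeSemiring c ℓ) where
  open CommutativeSemiring S hiding (zero)
  open Exp S using (_^_)
  open Binomial S using (theorem; binomialTerm)
  open Mult semiring using (×-congˡ; ×-congʳ; ×-assoc-*) renaming (_×_ to _·_)
  open Sum +-commutativeMonoid using (sum-cong-≋; sum-init-last; sum-replicate-zero) renaming (sum to sumᵥ)
  open import Relation.Binary.Reasoning.Setoid setoid

  1^n≈1 : ∀ n → 1# ^ n ≈ 1#
  1^n≈1 zero    = refl
  1^n≈1 (suc n) = trans (*-identityˡ _) (1^n≈1 n)

  -- The binomial theorem with all inner terms gone. The exponent has the form `suc m` so that the
  -- first and the last term can be split off the sum.
  [x+1]^n≈x^n+1 : ∀ m → (∀ k → 0 < k → k < suc m → (suc m C k) · 1# ≈ 0#) →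
    ∀ x → (x + 1#) ^ suc m ≈ x ^ suc m + 1#
  [x+1]^n≈x^n+1 m C≈0 x = begin
    (x + 1#) ^ n                            ≈⟨ theorem n x 1# ⟩
    term Fin.zero + sumᵥ (term ∘ Fin.suc)    ≈⟨ +-congˡ (sum-init-last (term ∘ Fin.suc)) ⟩
    term Fin.zero + (sumᵥ (term ∘ Fin.suc ∘ inject₁) + term (fromℕ n))
      ≈⟨ +-cong first (+-cong (trans (sum-cong-≋ middle) (sum-replicate-zero m)) last) ⟩
    1# + (0# + x ^ n)                       ≈⟨ +-congˡ (+-identityˡ _) ⟩
    1# + x ^ n                              ≈⟨ +-comm _ _ ⟩
    x ^ n + 1#                              ∎
    where
    n = suc m
    term = binomialTerm x 1# n
    first : term Fin.zero ≈ 1#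
    first = trans (+-identityʳ _) (trans (*-identityˡ _) (1^n≈1 n))
    last : term (fromℕ n) ≈ x ^ n
    last = begin
      (n C toℕ (fromℕ n)) · (x ^ toℕ (fromℕ n) * 1# ^ (n ∸ toℕ (fromℕ n)))
        ≡⟨ ≡.cong (λ k → (n C k) · (x ^ k * 1# ^ (n ∸ k))) (Fin.toℕ-fromℕ n) ⟩
      (n C n) · (x ^ n * 1# ^ (n ∸ n))  ≈⟨ ×-congˡ (nCn≡1 n) ⟩
      x ^ n * 1# ^ (n ∸ n) + 0#         ≈⟨ +-identityʳ _ ⟩
      x ^ n * 1# ^ (n ∸ n)              ≈⟨ *-congˡ (1^n≈1 (n ∸ n)) ⟩
      x ^ n * 1#                        ≈⟨ *-identityʳ _ ⟩
      x ^ n                             ∎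
    middle : ∀ i → term (Fin.suc (inject₁ i)) ≈ 0#
    middle i = begin
      (n C k) · y          ≈⟨ ×-congʳ (n C k) (*-identityˡ y) ⟨
      (n C k) · (1# * y)   ≈⟨ ×-assoc-* (n C k) 1# y ⟨
      (n C k) · 1# * y
        ≈⟨ *-congʳ (C≈0 k (s≤s z≤n) (s≤s (≡.subst (_< m) (≡.sym (Fin.toℕ-inject₁ i)) (Fin.toℕ<n i)))) ⟩
      0# * y               ≈⟨ zeroˡ y ⟩
      0#                   ∎
      where
      k = suc (toℕ (inject₁ i))
      y = x ^ k * 1# ^ (n ∸ k)

-- Binomial coefficients and divisibility by a prime

nCk*k!*[n∸k]!≡n! : ∀ {n k} → k ≤ n → (n C k) ℕ.* (k ! ℕ.* (n ∸ k) !) ≡ n !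
nCk*k!*[n∸k]!≡n! {n} {k} k≤n = ≡.trans (≡.cong (ℕ._* (k ! ℕ.* (n ∸ k) !)) (nCk≡n!/k![n-k]! k≤n))
  (ℕ.m/n*n≡m {{ℕ.m*n≢0 (k !) ((n ∸ k) !) {{ℕ._!≢0 k}} {{ℕ._!≢0 (n ∸ k)}}}} (k![n∸k]!∣n! k≤n))

module _ {p} (pr : Prime p) where

  prime∤! : ∀ {n} → n < p → ¬ p ∣ n !
  prime∤! {zero}  _   p∣1 = contradiction (ℕ.∣1⇒≡1 p∣1) (ℕ.nonTrivial⇒≢1 {{prime⇒nonTrivial pr}})
  prime∤! {suc n} n<p p∣! with euclidsLemma (suc n) (n !) pr p∣!
  ... | inj₁ p∣n  = ℕ.>⇒∤ n<p p∣n
  ... | inj₂ p∣n! = prime∤! (ℕ.<⇒≤ n<p) p∣n!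

  prime∤C : ∀ {n k} → k ≤ n → n < p → ¬ p ∣ n C k
  prime∤C {n} {k} k≤n n<p p∣C =
    prime∤! n<p (≡.subst (p ∣_) (nCk*k!*[n∸k]!≡n! k≤n) (ℕ.∣m⇒∣m*n _ p∣C))

  -- In C(p, k) · k! · (p - k)! = p! the prime divides the right side but neither factorial on the
  -- left, both being factorials of numbers below `p`.
  prime∣C : ∀ k → 0 < k → k < p → p ∣ p C k
  prime∣C k 0<k k<p with euclidsLemma (p C k) _ pr (≡.subst (p ∣_) (≡.sym (nCk*k!*[n∸k]!≡n! (ℕ.<⇒≤ k<p))) p∣p!)
    where
    p∣p! : p ∣ p !
    p∣p! = ≡.subst (λ n → n ∣ n !) (ℕ.suc-pred p {{prime⇒nonZero pr}}) (ℕ.m∣m*n _)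
  ... | inj₁ p∣C = p∣C
  ... | inj₂ p∣! with euclidsLemma (k !) ((p ∸ k) !) pr p∣!
  ...   | inj₁ p∣k! = contradiction p∣k! (prime∤! k<p)
  ...   | inj₂ p∣!′ = contradiction p∣!′ (prime∤! (ℕ.∸-monoʳ-< 0<k (ℕ.<⇒≤ k<p)))

-- The integers modulo p

module Residues (p : ℕ) where

  infix 4 _≋_

  record _≋_ (x y : ℤ) : Set where
    constructor congruent
    field divisible : + p ∣ℤ x ℤ.- y

  open _≋_

  ≋-reflexive : ∀ {x y} → x ≡ y → x ≋ y
  ≋-reflexive {x} ≡.refl = congruent (divides 0ℤ (ℤ.+-inverseʳ x))

  ≋-by : ∀ {x y z} → + p ∣ℤ z → z ≡ x ℤ.- y → x ≋ y
  ≋-by p∣z ≡.refl = congruent p∣z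

  ≋-sym : ∀ {x y} → x ≋ y → y ≋ x
  ≋-sym {x} {y} x≋y = ≋-by (ℤ.∣m⇒∣-m (divisible x≋y)) (identity x y)
    where
    identity : ∀ x y → ℤ.- (x ℤ.- y) ≡ y ℤ.- x
    identity = ℤ.solve-∀

  ≋-trans : ∀ {x y z} → x ≋ y → y ≋ z → x ≋ z
  ≋-trans {x} {y} {z} x≋y y≋z = ≋-by (ℤ.∣m∣n⇒∣m+n (divisible x≋y) (divisible y≋z)) (identity x y z)
    where
    identity : ∀ x y z → x ℤ.- y ℤ.+ (y ℤ.- z) ≡ x ℤ.- z
    identity = ℤ.solve-∀

  ≋-+-cong : ∀ {x y u v} → x ≋ y → u ≋ v → x ℤ.+ u ≋ y ℤ.+ v
  ≋-+-cong {x} {y} {u} {v} x≋y u≋v = ≋-by (ℤ.∣m∣n⇒∣m+n (divisible x≋y) (divisible u≋v)) (identity x y u v)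
    where
    identity : ∀ x y u v → x ℤ.- y ℤ.+ (u ℤ.- v) ≡ x ℤ.+ u ℤ.- (y ℤ.+ v)
    identity = ℤ.solve-∀

  ≋-*-cong : ∀ {x y u v} → x ≋ y → u ≋ v → x ℤ.* u ≋ y ℤ.* v
  ≋-*-cong {x} {y} {u} {v} x≋y u≋v =
    ≋-by (ℤ.∣m∣n⇒∣m+n (ℤ.∣n⇒∣m*n x (divisible u≋v)) (ℤ.∣n⇒∣m*n v (divisible x≋y))) (identity x y u v)
    where
    identity : ∀ x y u v → x ℤ.* (u ℤ.- v) ℤ.+ v ℤ.* (x ℤ.- y) ≡ x ℤ.* u ℤ.- y ℤ.* v
    identity = ℤ.solve-∀

  ≋-neg-cong : ∀ {x y} → x ≋ y → ℤ.- x ≋ ℤ.- y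
  ≋-neg-cong {x} {y} x≋y = ≋-by (ℤ.∣m⇒∣-m (divisible x≋y)) (identity x y)
    where
    identity : ∀ x y → ℤ.- (x ℤ.- y) ≡ ℤ.- x ℤ.- (ℤ.- y)
    identity = ℤ.solve-∀

  -- The residues are represented by ℤ up to congruence, so that every ring law is inherited from ℤ.
  residueRing : CommutativeRing 0ℓ 0ℓ
  residueRing = record
    { Carrier = ℤ ; _≈_ = _≋_ ; _+_ = ℤ._+_ ; _*_ = ℤ._*_ ; -_ = ℤ.-_ ; 0# = 0ℤ ; 1# = 1ℤ
    ; isCommutativeRing = record
      { isRing = record
        { +-isAbelianGroup = record
          { isGroup = record
            { isMonoid = record
              { isSemigroup = record
                { isMagma = record
                  { isEquivalence = record { refl = ≋-reflexive ≡.refl ; sym = ≋-sym ; trans = ≋-trans }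
                  ; ∙-cong = ≋-+-cong
                  }
                ; assoc = λ x y z → ≋-reflexive (ℤ.+-assoc x y z)
                }
              ; identity = ≋-reflexive ∘ ℤ.+-identityˡ , ≋-reflexive ∘ ℤ.+-identityʳ
              }
            ; inverse = ≋-reflexive ∘ ℤ.+-inverseˡ , ≋-reflexive ∘ ℤ.+-inverseʳ
            ; ⁻¹-cong = ≋-neg-cong
            }
          ; comm = λ x y → ≋-reflexive (ℤ.+-comm x y)
          }
        ; *-cong = ≋-*-cong
        ; *-assoc = λ x y z → ≋-reflexive (ℤ.*-assoc x y z)
        ; *-identity = ≋-reflexive ∘ ℤ.*-identityˡ , ≋-reflexive ∘ ℤ.*-identityʳ
        ; distrib = (λ x y z → ≋-reflexive (ℤ.*-distribˡ-+ x y z)) , (λ x y z → ≋-reflexive (ℤ.*-distribʳ-+ x y z))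
        }
      ; *-comm = λ x y → ≋-reflexive (ℤ.*-comm x y)
      }
    }

  ∣⇒≋0 : ∀ {n} → p ∣ n → + n ≋ 0ℤ
  ∣⇒≋0 {n} p∣n = ≋-by (ℤ.∣ᵤ⇒∣ p∣n) (≡.sym (ℤ.+-identityʳ (+ n)))

  ≋⇒∣∣-∣ : ∀ {x y} → x ≋ y → p ∣ ℤ.∣ x ℤ.- y ∣
  ≋⇒∣∣-∣ (congruent d) = ℤ.∣⇒∣ᵤ d

  ≋0⇒∣ : ∀ {x} → x ≋ 0ℤ → p ∣ ℤ.∣ x ∣
  ≋0⇒∣ {x} x≋0 = ≡.subst (λ z → p ∣ ℤ.∣ z ∣) (ℤ.+-identityʳ x) (≋⇒∣∣-∣ x≋0)

  -- The difference is at most the maximum of `m` and `n` in absolute value, hence below `p`, and 0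
  -- is the only such multiple of `p`.
  toℕ-injective-≋ : ∀ {m n} → m < p → n < p → + m ≋ + n → m ≡ n
  toℕ-injective-≋ {m} {n} m<p n<p m≋n = ℤ.+-injective (ℤ.i-j≡0⇒i≡j (+ m) (+ n)
    (ℤ.∣i∣≡0⇒i≡0 (small (≋⇒∣∣-∣ m≋n) (ℕ.≤-<-trans bound (ℕ.⊔-lub m<p n<p)))))
    where
    bound : ℤ.∣ + m ℤ.- + n ∣ ≤ m ℕ.⊔ n
    bound = ≡.subst (λ z → ℤ.∣ z ∣ ≤ m ℕ.⊔ n) (≡.sym (ℤ.[+m]-[+n]≡m⊖n m n)) (ℤ.∣m⊝n∣≤m⊔n m n)
    small : ∀ {k} → p ∣ k → k < p → k ≡ 0
    small {zero}  _   _   = ≡.refl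
    small {suc k} p∣k k<p = contradiction p∣k (ℕ.>⇒∤ k<p)

  +%≋+ : ∀ .{{_ : NonZero p}} n → + (n ℕ.% p) ≋ + n
  +%≋+ n = ≋-by (divides (ℤ.- (+ (n ℕ./ p))) ≡.refl) (≡.trans (identity (+ (n ℕ.% p)) (+ (n ℕ./ p)) (+ p))
    (≡.cong (λ z → + (n ℕ.% p) ℤ.- z) (≡.trans (≡.cong (λ y → + (n ℕ.% p) ℤ.+ y) (≡.sym (ℤ.pos-* (n ℕ./ p) p)))
      (≡.cong +_ (≡.sym (ℕ.m≡m%n+[m/n]*n n p))))))
    where
    identity : ∀ r q m → ℤ.- q ℤ.* m ≡ r ℤ.- (r ℤ.+ q ℤ.* m)
    identity = ℤ.solve-∀

-- Fermat's little theorem and inverses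

module PrimeResidues {p} (pr : Prime p) where
  open Residues p public
  open CommutativeRing residueRing
    using (setoid; commutativeSemiring; semiring; ring; +-group; *-comm; +-congʳ; trans)
  open GroupProperties +-group using (x∙y⁻¹≈ε⇒x≈y; x≈y⇒x∙y⁻¹≈ε)
  open RingProperties ring using (x[y-z]≈xy-xz)
  open Exp commutativeSemiring using (_^_; ^-congˡ)
  open Mult semiring using () renaming (_×_ to _·_)
  open import Relation.Binary.Reasoning.Setoid setoid

  instance
    p≢0 : NonZero p
    p≢0 = prime⇒nonZero pr

  domain : ∀ x y → x ℤ.* y ≋ 0ℤ → x ≋ 0ℤ ⊎ y ≋ 0ℤ
  domain x y xy≋0 with euclidsLemma ℤ.∣ x ∣ ℤ.∣ y ∣ pr (≡.subst (p ∣_) (ℤ.abs-* x y) (≋0⇒∣ xy≋0))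
  ... | inj₁ p∣x = inj₁ (≋-by (ℤ.∣ᵤ⇒∣ p∣x) (≡.sym (ℤ.+-identityʳ x)))
  ... | inj₂ p∣y = inj₂ (≋-by (ℤ.∣ᵤ⇒∣ p∣y) (≡.sym (ℤ.+-identityʳ y)))

  n·1≡+n : ∀ n → n · 1ℤ ≡ + n
  n·1≡+n zero    = ≡.refl
  n·1≡+n (suc n) = ≡.cong (λ z → 1ℤ ℤ.+ z) (n·1≡+n n)

  -- Induction on `n`: raising to the power `p` respects adding 1, because `p` divides its inner
  -- binomial coefficients.
  fermat-ℕ : ∀ n → (+ n) ^ p ≋ + n
  fermat-ℕ zero = ≡.subst (λ q → 0ℤ ^ q ≋ 0ℤ) (ℕ.suc-pred p) (≋-reflexive ≡.refl)
  fermat-ℕ (suc n) = begin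
    (+ suc n) ^ p         ≈⟨ ^-congˡ p (≋-reflexive (ℤ.+-comm 1ℤ (+ n))) ⟩
    (+ n ℤ.+ 1ℤ) ^ p
      ≈⟨ ≡.subst (λ q → (∀ k → 0 < k → k < q → (q C k) · 1ℤ ≋ 0ℤ) → (+ n ℤ.+ 1ℤ) ^ q ≋ (+ n) ^ q ℤ.+ 1ℤ)
          (ℕ.suc-pred p) (λ C≈0 → [x+1]^n≈x^n+1 commutativeSemiring (ℕ.pred p) C≈0 (+ n))
              (λ k 0<k k<p → trans (≋-reflexive (n·1≡+n (p C k))) (∣⇒≋0 (prime∣C pr k 0<k k<p))) ⟩
    (+ n) ^ p ℤ.+ 1ℤ      ≈⟨ +-congʳ (fermat-ℕ n) ⟩
    + n ℤ.+ 1ℤ          ≡⟨ ℤ.+-comm (+ n) 1ℤ ⟩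
    + suc n             ∎

  fermat : ∀ x → x ^ p ≋ x
  fermat x = begin
    x ^ p                ≈⟨ ^-congˡ p x≋r ⟩
    (+ (x ℤ.%ℕ p)) ^ p     ≈⟨ fermat-ℕ (x ℤ.%ℕ p) ⟩
    + (x ℤ.%ℕ p)         ≈⟨ x≋r ⟨
    x                    ∎
    where
    identity : ∀ r z → z ≡ r ℤ.+ z ℤ.- r
    identity = ℤ.solve-∀
    x≋r : x ≋ + (x ℤ.%ℕ p)
    x≋r = ≋-by (divides (x ℤ./ℕ p) ≡.refl) (≡.trans (identity (+ (x ℤ.%ℕ p)) _)
      (≡.cong (ℤ._- + (x ℤ.%ℕ p)) (≡.sym (ℤ.a≡a%ℕn+[a/ℕn]*n x p))))

  -- The product x (x^q - 1) = x^p - x is zero, and there are no zero divisors.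
  fermat-unit : ∀ {q x} → p ≡ suc q → ¬ x ≋ 0ℤ → x ^ q ≋ 1ℤ
  fermat-unit {q} {x} p≡1+q x≉0 =
    [ (λ x≋0 → contradiction x≋0 x≉0) , x∙y⁻¹≈ε⇒x≈y (x ^ q) 1ℤ ]′ (domain x (x ^ q ℤ.- 1ℤ) (begin
      x ℤ.* (x ^ q ℤ.- 1ℤ)       ≈⟨ x[y-z]≈xy-xz x (x ^ q) 1ℤ ⟩
      x ^ suc q ℤ.- x ℤ.* 1ℤ     ≡⟨ ≡.cong₂ (λ n y → x ^ n ℤ.- y) (≡.sym p≡1+q) (ℤ.*-identityʳ x) ⟩
      x ^ p ℤ.- x                ≈⟨ x≈y⇒x∙y⁻¹≈ε (fermat x) ⟩
      0ℤ                         ∎))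

  inverse : ∀ x → ¬ x ≋ 0ℤ → ∃ λ y → y ℤ.* x ≋ 1ℤ
  inverse x x≉0 = x ^ (p ∸ 2) , trans (*-comm _ x)
    (fermat-unit (≡.sym (ℕ.m+[n∸m]≡n (ℕ.nonTrivial⇒n>1 p {{prime⇒nonTrivial pr}}))) x≉0)

-- Counting representations

indicator : Bool → ℕ
indicator true  = 1
indicator false = 0

module _ {a} {A : Set a} where

  ∑ : List A → (A → ℕ) → ℕ
  ∑ xs f = sum (map f xs)

  ∑-mono : ∀ xs {f g : A → ℕ} → (∀ x → f x ≤ g x) → ∑ xs f ≤ ∑ xs g
  ∑-mono []       f≤g = z≤n
  ∑-mono (x ∷ xs) f≤g = ℕ.+-mono-≤ (f≤g x) (∑-mono xs f≤g)

  ∑-zero : ∀ (xs : List A) → ∑ xs (λ _ → 0) ≡ 0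
  ∑-zero []       = ≡.refl
  ∑-zero (x ∷ xs) = ∑-zero xs

  ∑-+ : ∀ xs (f g : A → ℕ) → ∑ xs (λ x → f x ℕ.+ g x) ≡ ∑ xs f ℕ.+ ∑ xs g
  ∑-+ []       f g = ≡.refl
  ∑-+ (x ∷ xs) f g rewrite ∑-+ xs f g = interchange (f x) (g x) (∑ xs f) (∑ xs g)
    where
    interchange : ∀ m n o q → m ℕ.+ n ℕ.+ (o ℕ.+ q) ≡ m ℕ.+ o ℕ.+ (n ℕ.+ q)
    interchange = solve-∀

  ∑-*ˡ : ∀ c xs (f : A → ℕ) → ∑ xs (λ x → c ℕ.* f x) ≡ c ℕ.* ∑ xs f
  ∑-*ˡ c []       f = ≡.sym (ℕ.*-zeroʳ c)
  ∑-*ˡ c (x ∷ xs) f rewrite ∑-*ˡ c xs f = ≡.sym (ℕ.*-distribˡ-+ c (f x) (∑ xs f))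

  length-filterᵇ : ∀ P (xs : List A) → length (filterᵇ P xs) ≡ ∑ xs (indicator ∘ P)
  length-filterᵇ P []       = ≡.refl
  length-filterᵇ P (x ∷ xs) with P x
  ... | true  = ≡.cong suc (length-filterᵇ P xs)
  ... | false = length-filterᵇ P xs

  injection⇒≤length : ∀ {n} (xs : List A) (s : Fin n → A) → (∀ {i j} → s i ≡ s j → i ≡ j) →
    (∀ i → s i ∈ xs) → n ≤ length xs
  injection⇒≤length xs s s-injective s∈xs = Fin.injective⇒≤ {f = λ i → index (s∈xs i)} λ {i} {j} eq →
    s-injective (≡.trans (Any.lookup-index (s∈xs i))
      (≡.trans (≡.cong (lookup xs) eq) (≡.sym (Any.lookup-index (s∈xs j)))))

module _ {a b} {A : Set a} {B : Set b} where

  ∑-swap : ∀ xs ys (f : A → B → ℕ) → ∑ xs (λ x → ∑ ys (f x)) ≡ ∑ ys (λ y → ∑ xs (λ x → f x y))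
  ∑-swap []       ys f = ≡.sym (∑-zero ys)
  ∑-swap (x ∷ xs) ys f rewrite ∑-swap xs ys f = ≡.sym (∑-+ ys (f x) (λ y → ∑ xs (λ x → f x y)))

  ∑-cartesianProduct : ∀ xs ys (f : A → ℕ) (g : B → ℕ) →
    ∑ (cartesianProduct xs ys) (λ xy → f (proj₁ xy) ℕ.* g (proj₂ xy)) ≡ ∑ xs f ℕ.* ∑ ys g
  ∑-cartesianProduct []       ys f g = ≡.refl
  ∑-cartesianProduct (x ∷ xs) ys f g = begin
    ∑ (map (x ,_) ys ++ cartesianProduct xs ys) h           ≡⟨ ≡.cong sum (map-++ h (map (x ,_) ys) _) ⟩
    sum (map h (map (x ,_) ys) ++ map h (cartesianProduct xs ys))  ≡⟨ sum-++ (map h (map (x ,_) ys)) _ ⟩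
    ∑ (map (x ,_) ys) h ℕ.+ ∑ (cartesianProduct xs ys) h
      ≡⟨ ≡.cong₂ ℕ._+_ (≡.cong sum (≡.sym (map-∘ ys))) (∑-cartesianProduct xs ys f g) ⟩
    ∑ ys (λ y → f x ℕ.* g y) ℕ.+ ∑ xs f ℕ.* ∑ ys g
      ≡⟨ ≡.cong (ℕ._+ ∑ xs f ℕ.* ∑ ys g) (∑-*ˡ (f x) ys g) ⟩
    f x ℕ.* ∑ ys g ℕ.+ ∑ xs f ℕ.* ∑ ys g                    ≡⟨ ℕ.*-distribʳ-+ (∑ ys g) (f x) (∑ xs f) ⟨
    (f x ℕ.+ ∑ xs f) ℕ.* ∑ ys g                             ∎
    where
    open ≡.≡-Reasoning
    h : A × B → ℕ
    h xy = f (proj₁ xy) ℕ.* g (proj₂ xy)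

-- A pair with sum `s` is counted in r(x) for at most one x. The target `s` may be any natural
-- number, so that it can decrease along with `n`.
sum-tabulate-indicator-≤1 : ∀ n s → sum (tabulate {n = n} (λ x → indicator (s ≡ᵇ toℕ x))) ≤ 1
sum-tabulate-indicator-≤1 zero    s       = z≤n
sum-tabulate-indicator-≤1 (suc n) zero    = s≤s (ℕ.≤-reflexive (zeros n))
  where
  zeros : ∀ n → sum (tabulate {n = n} (λ _ → 0)) ≡ 0
  zeros zero    = ≡.refl
  zeros (suc n) = zeros n
sum-tabulate-indicator-≤1 (suc n) (suc s) = sum-tabulate-indicator-≤1 n s

-- Subsets as lists, and the representation function

module _ {p : ℕ} (S : Subset p) where

  elements : List (Fin p)
  elements = filterᵇ (Vec.lookup S) (allFin p)

  ∈⇒∈-elements : ∀ {x} → x Subset.∈ S → x ∈ elements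
  ∈⇒∈-elements x∈S =
    ∈-filter⁺ (T? ∘ Vec.lookup S) (∈-allFin _) (Equivalence.from T-≡ ([]=⇒lookup x∈S))

  ∈-elements⇒∈ : ∀ {x} → x ∈ elements → x Subset.∈ S
  ∈-elements⇒∈ {x} x∈ =
    lookup⇒[]= x S (Equivalence.to T-≡ (proj₂ (∈-filter⁻ (T? ∘ Vec.lookup S) {xs = allFin p} x∈)))

module _ (p : ℕ) .{{_ : NonZero p}} (A B : Subset p) where

  -- Double counting: after exchanging the sums, each pair from A × B contributes at most one and
  -- every other pair nothing.
  ∑-rep≤ : ∑ (allFin p) (rep p A B) ≤ length (elements A) ℕ.* length (elements B)
  ∑-rep≤ = begin
    ∑ (allFin p) (rep p A B)   ≤⟨ ∑-mono (allFin p) (λ x → ℕ.≤-reflexive (length-filterᵇ _ pairs)) ⟩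
    ∑ (allFin p) (λ x → ∑ pairs (hit x))  ≡⟨ ∑-swap (allFin p) pairs hit ⟩
    ∑ pairs (λ ab → ∑ (allFin p) (λ x → hit x ab))  ≤⟨ ∑-mono pairs (λ ab → hits≤ (proj₁ ab) (proj₂ ab)) ⟩
    ∑ pairs (λ ab → inA (proj₁ ab) ℕ.* inB (proj₂ ab))  ≡⟨ ∑-cartesianProduct (allFin p) (allFin p) inA inB ⟩
    ∑ (allFin p) inA ℕ.* ∑ (allFin p) inB
      ≡⟨ ≡.cong₂ ℕ._*_ (length-filterᵇ (Vec.lookup A) (allFin p)) (length-filterᵇ (Vec.lookup B) (allFin p)) ⟨
    length (elements A) ℕ.* length (elements B) ∎
    where
    open ℕ.≤-Reasoning
    pairs = cartesianProduct (allFin p) (allFin p)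
    inA = indicator ∘ Vec.lookup A
    inB = indicator ∘ Vec.lookup B
    hit : Fin p → Fin p × Fin p → ℕ
    hit x (a , b) = indicator (Vec.lookup A a ∧ Vec.lookup B b ∧ (toℕ (addF p a b) ≡ᵇ toℕ x))
    hits≤ : ∀ a b → ∑ (allFin p) (λ x → hit x (a , b)) ≤ inA a ℕ.* inB b
    hits≤ a b with Vec.lookup A a | Vec.lookup B b
    ... | false | _     = ℕ.≤-reflexive (∑-zero (allFin p))
    ... | true  | false = ℕ.≤-reflexive (∑-zero (allFin p))
    ... | true  | true  = ≡.subst (_≤ 1) (≡.cong sum (≡.sym (map-tabulate {n = p} id (λ x → indicator (s ≡ᵇ toℕ x)))))
      (sum-tabulate-indicator-≤1 p s)
      where s = toℕ (addF p a b)

  InSumset⇒0<rep : ∀ {x} → InSumset p A B x → 0 < rep p A B x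
  InSumset⇒0<rep (a , b , a∈A , b∈B , a+b≡x) = ∈-length (∈-filter⁺ (T? ∘ _)
    (∈-cartesianProduct⁺ (∈-allFin a) (∈-allFin b))
    (Equivalence.from T-∧ (Equivalence.from T-≡ ([]=⇒lookup a∈A) ,
      Equivalence.from T-∧ (Equivalence.from T-≡ ([]=⇒lookup b∈B) , ℕ.≡⇒≡ᵇ _ _ (≡.cong toℕ a+b≡x)))))

  -- An element with at least two representations covers its share 2 by r(x) alone; one with a
  -- single representation needs the extra 1 from `uniqueCount`.
  support≤uniqueCount : 2 ℕ.* length (filterᵇ (λ x → 0 <ᵇ rep p A B x) (allFin p)) ≤
    uniqueCount p A B ℕ.+ length (elements A) ℕ.* length (elements B)
  support≤uniqueCount = begin
    2 ℕ.* length (filterᵇ (λ x → 0 <ᵇ r x) (allFin p)) ≡⟨ ≡.cong (2 ℕ.*_) (length-filterᵇ _ (allFin p)) ⟩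
    2 ℕ.* ∑ (allFin p) (λ x → indicator (0 <ᵇ r x))  ≡⟨ ∑-*ˡ 2 (allFin p) _ ⟨
    ∑ (allFin p) (λ x → 2 ℕ.* indicator (0 <ᵇ r x))  ≤⟨ ∑-mono (allFin p) (λ x → pointwise (r x)) ⟩
    ∑ (allFin p) (λ x → indicator (r x ≡ᵇ 1) ℕ.+ r x)  ≡⟨ ∑-+ (allFin p) _ r ⟩
    ∑ (allFin p) (λ x → indicator (r x ≡ᵇ 1)) ℕ.+ ∑ (allFin p) r
      ≡⟨ ≡.cong (ℕ._+ ∑ (allFin p) r) (length-filterᵇ _ (allFin p)) ⟨
    uniqueCount p A B ℕ.+ ∑ (allFin p) r ≤⟨ ℕ.+-monoʳ-≤ (uniqueCount p A B) ∑-rep≤ ⟩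
    uniqueCount p A B ℕ.+ length (elements A) ℕ.* length (elements B) ∎
    where
    open ℕ.≤-Reasoning
    r = rep p A B
    pointwise : ∀ n → 2 ℕ.* indicator (0 <ᵇ n) ≤ indicator (n ≡ᵇ 1) ℕ.+ n
    pointwise 0             = z≤n
    pointwise 1             = s≤s (s≤s z≤n)
    pointwise (suc (suc n)) = s≤s (s≤s z≤n)

-- The rational bound on ln 2

halfPow-nonNegative : ∀ k → ℚ.NonNegative (halfPow k)
halfPow-nonNegative zero    = _
halfPow-nonNegative (suc k) = ℚ.nonNeg*nonNeg⇒nonNeg (halfPow k) {{halfPow-nonNegative k}} ((+ 1) ℚ./ 2)

lnTwoTerm-nonNegative : ∀ k j → ℚ.NonNegative (((+ 1) ℚ./ suc k) ℚ.* halfPow j)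
lnTwoTerm-nonNegative k j =
  ℚ.nonNeg*nonNeg⇒nonNeg ((+ 1) ℚ./ suc k) {{ℚ.normalize-nonNeg 1 (suc k)}} (halfPow j) {{halfPow-nonNegative j}}

p≤p+nonNegative : ∀ p q → ℚ.NonNegative q → p ℚ.≤ p ℚ.+ q
p≤p+nonNegative p q q≥0 =
  ≡.subst (ℚ._≤ p ℚ.+ q) (ℚ.+-identityʳ p) (ℚ.+-monoʳ-≤ p (ℚ.nonNegative⁻¹ q {{q≥0}}))

-- 17/25 < Σ_{k≤4} 1/(k 2^k) < ln 2, and ((N + 8/5) · 17/25)² ≥ 2N + 1 for every N.
lnTwoPartial-≥ : ∀ j → (+ 17) ℚ./ 25 ℚ.≤ lnTwoPartial (4 ℕ.+ j)
lnTwoPartial-≥ zero    = from-yes ((+ 17) ℚ./ 25 ℚ.≤? lnTwoPartial 4)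
lnTwoPartial-≥ (suc j) = ℚ.≤-trans (lnTwoPartial-≥ j)
  (p≤p+nonNegative (lnTwoPartial (4 ℕ.+ j)) _ (lnTwoTerm-nonNegative (4 ℕ.+ j) (5 ℕ.+ j)))

-- From K = 4 on the partial sum suffices. The earlier partial sums are at most 2/3 < 17/25, so the
-- remainder term has to help, and these four cases are decided by computation.
lnTwoUpper-≥ : ∀ K → (+ 17) ℚ./ 25 ℚ.≤ lnTwoUpper K
lnTwoUpper-≥ 0 = from-yes ((+ 17) ℚ./ 25 ℚ.≤? lnTwoUpper 0)
lnTwoUpper-≥ 1 = from-yes ((+ 17) ℚ./ 25 ℚ.≤? lnTwoUpper 1)
lnTwoUpper-≥ 2 = from-yes ((+ 17) ℚ./ 25 ℚ.≤? lnTwoUpper 2)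
lnTwoUpper-≥ 3 = from-yes ((+ 17) ℚ./ 25 ℚ.≤? lnTwoUpper 3)
lnTwoUpper-≥ (suc (suc (suc (suc j)))) = ℚ.≤-trans (lnTwoPartial-≥ j)
  (p≤p+nonNegative (lnTwoPartial (4 ℕ.+ j)) _ (lnTwoTerm-nonNegative (4 ℕ.+ j) (4 ℕ.+ j)))

square-mono-≤ : ∀ {x y} → 0ℚ ℚ.≤ x → x ℚ.≤ y → x ℚ.* x ℚ.≤ y ℚ.* y
square-mono-≤ {x} {y} 0≤x x≤y = ℚ.≤-trans
  (ℚ.*-monoˡ-≤-nonNeg x {{ℚ.nonNegative 0≤x}} x≤y)
  (ℚ.*-monoʳ-≤-nonNeg y {{ℚ.nonNegative (ℚ.≤-trans 0≤x x≤y)}} x≤y)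

-- This is 2N + 1 ≤ ((N + 8/5) · 17/25)² multiplied by 15625 = 125². The difference 7225 N² - 8130 N
-- + 2871 has a negative coefficient; substituting N = n + 2 makes all coefficients positive, and N
-- = 0, 1 are computed.
quadratic-bound : ∀ N → 15625 ℕ.* (2 ℕ.* N ℕ.+ 1) ℕ.≤ ((5 ℕ.* N ℕ.+ 8) ℕ.* 17) ℕ.* ((5 ℕ.* N ℕ.+ 8) ℕ.* 17)
quadratic-bound zero = ℕ.≤ᵇ⇒≤ _ _ _
quadratic-bound (suc zero) = ℕ.≤ᵇ⇒≤ _ _ _
quadratic-bound (suc (suc n)) = ≡.subst (15625 ℕ.* (2 ℕ.* suc (suc n) ℕ.+ 1) ℕ.≤_) (identity n) (ℕ.m≤m+n _ _)
  where
  identity : ∀ n → 15625 ℕ.* (2 ℕ.* suc (suc n) ℕ.+ 1) ℕ.+ (7225 ℕ.* (n ℕ.* n) ℕ.+ 20770 ℕ.* n ℕ.+ 15511) ≡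
    ((5 ℕ.* suc (suc n) ℕ.+ 8) ℕ.* 17) ℕ.* ((5 ℕ.* suc (suc n) ℕ.+ 8) ℕ.* 17)
  identity = solve-∀

lowerBound : ℕ → ℚ
lowerBound N = ((+ N) ℚ./ 1 ℚ.+ (+ 8) ℚ./ 5) ℚ.* ((+ 17) ℚ./ 25)

-- Unnormalised fractions avoid the gcd, which does not reduce for a variable `N`. The common
-- denominator 1 · 5 · 25 = 125 is stored as its predecessor 124.
toℚᵘ-lowerBound : ∀ N → ℚ.toℚᵘ (lowerBound N) ℚᵘ.≃ mkℚᵘ (+ ((5 ℕ.* N ℕ.+ 8) ℕ.* 17)) 124
toℚᵘ-lowerBound N = begin
  ℚ.toℚᵘ (lowerBound N)  ≈⟨ ℚ.toℚᵘ-homo-* ((+ N) ℚ./ 1 ℚ.+ (+ 8) ℚ./ 5) ((+ 17) ℚ./ 25) ⟩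
  ℚ.toℚᵘ ((+ N) ℚ./ 1 ℚ.+ (+ 8) ℚ./ 5) ℚᵘ.* mkℚᵘ (+ 17) 24
    ≈⟨ ℚᵘ.*-congʳ (ℚ.toℚᵘ-homo-+ ((+ N) ℚ./ 1) ((+ 8) ℚ./ 5)) ⟩
  (ℚ.toℚᵘ ((+ N) ℚ./ 1) ℚᵘ.+ mkℚᵘ (+ 8) 4) ℚᵘ.* mkℚᵘ (+ 17) 24
    ≈⟨ ℚᵘ.*-congʳ (ℚᵘ.+-congˡ (mkℚᵘ (+ 8) 4) (ℚ.toℚᵘ-fromℚᵘ (mkℚᵘ (+ N) 0))) ⟩
  (mkℚᵘ (+ N) 0 ℚᵘ.+ mkℚᵘ (+ 8) 4) ℚᵘ.* mkℚᵘ (+ 17) 24 ≡⟨ ≡.cong (λ n → mkℚᵘ n 124) numerator ⟩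
  mkℚᵘ (+ ((5 ℕ.* N ℕ.+ 8) ℕ.* 17)) 124 ∎
  where
  open ℚᵘ.≃-Reasoning
  numerator : (+ N ℤ.* + 5 ℤ.+ + 8) ℤ.* + 17 ≡ + ((5 ℕ.* N ℕ.+ 8) ℕ.* 17)
  numerator = ≡.trans (≡.cong (λ i → (i ℤ.+ + 8) ℤ.* + 17) (≡.trans (≡.sym (ℤ.pos-* N 5)) (≡.cong +_ (ℕ.*-comm N 5))))
    (≡.sym (ℤ.pos-* (5 ℕ.* N ℕ.+ 8) 17))

sqrtLeLn2Bound : ∀ p N → p ≤ 2 ℕ.* N ℕ.+ 1 → SqrtLeLn2Bound p N
sqrtLeLn2Bound p N p≤2N+1 K = ℚ.≤-trans p≤x² (square-mono-≤ (ℚ.nonNegative⁻¹ x {{x≥0}}) x≤c)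
  where
  s = (+ N) ℚ./ 1 ℚ.+ (+ 8) ℚ./ 5
  x = lowerBound N
  s≥0 : ℚ.NonNegative s
  s≥0 = ℚ.nonNeg+nonNeg⇒nonNeg ((+ N) ℚ./ 1) {{ℚ.normalize-nonNeg N 1}} ((+ 8) ℚ./ 5)
  x≥0 : ℚ.NonNegative x
  x≥0 = ℚ.nonNeg*nonNeg⇒nonNeg s {{s≥0}} ((+ 17) ℚ./ 25)
  x≤c : x ℚ.≤ s ℚ.* lnTwoUpper K
  x≤c = ℚ.*-monoˡ-≤-nonNeg s {{s≥0}} (lnTwoUpper-≥ K)
  n = (5 ℕ.* N ℕ.+ 8) ℕ.* 17
  numerators : p ℕ.* 15625 ≤ n ℕ.* n ℕ.* 1
  numerators = ℕ.≤-trans (ℕ.*-monoˡ-≤ 15625 p≤2N+1)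
    (≡.subst₂ _≤_ (ℕ.*-comm 15625 (2 ℕ.* N ℕ.+ 1)) (≡.sym (ℕ.*-identityʳ (n ℕ.* n))) (quadratic-bound N))
  p≤x² : (+ p) ℚ./ 1 ℚ.≤ x ℚ.* x
  p≤x² = ℚ.toℚᵘ-cancel-≤ (begin
    ℚ.toℚᵘ ((+ p) ℚ./ 1)         ≃⟨ ℚ.toℚᵘ-fromℚᵘ (mkℚᵘ (+ p) 0) ⟩
    mkℚᵘ (+ p) 0                  ≤⟨ *≤* (≡.subst₂ ℤ._≤_ (ℤ.pos-* p 15625)
        (≡.trans (ℤ.pos-* (n ℕ.* n) 1) (≡.cong (ℤ._* + 1) (ℤ.pos-* n n))) (ℤ.+≤+ numerators)) ⟩
    mkℚᵘ (+ n) 124 ℚᵘ.* mkℚᵘ (+ n) 124 ≃⟨ ℚᵘ.*-cong (toℚᵘ-lowerBound N) (toℚᵘ-lowerBound N) ⟨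
    ℚ.toℚᵘ x ℚᵘ.* ℚ.toℚᵘ x        ≃⟨ ℚ.toℚᵘ-homo-* x x ⟨
    ℚ.toℚᵘ (x ℚ.* x)              ∎)
    where open ℚᵘ.≤-Reasoning

-- Sumsets equal to the quadratic residues

odd-prime : ∀ {p} → Prime p → p ≢ 2 → ∃ λ d → 0 < d × p ≡ suc (2 ℕ.* d)
odd-prime {p} pr p≢2 = go (p ℕ.% 2) (p ℕ./ 2) ≡.refl (ℕ.m%n<n p 2) (ℕ.m≡m%n+[m/n]*n p 2)
  where
  go : ∀ r d → p ℕ.% 2 ≡ r → r < 2 → p ≡ r ℕ.+ d ℕ.* 2 → ∃ λ d → 0 < d × p ≡ suc (2 ℕ.* d)
  go 0 d even _ _ with prime⇒irreducible pr (ℕ.m%n≡0⇒n∣m p 2 even)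
  ... | inj₁ ()
  ... | inj₂ 2≡p = contradiction (≡.sym 2≡p) p≢2
  go 1 zero    _ _ p≡1 = contradiction p≡1 (ℕ.nonTrivial⇒≢1 {{prime⇒nonTrivial pr}})
  go 1 (suc d) _ _ p≡  = suc d , s≤s z≤n , ≡.trans p≡ (≡.cong suc (ℕ.*-comm (suc d) 2))
  go (suc (suc r)) _ _ (s≤s (s≤s ())) _

module QuadraticResidues {p d} (pr : Prime p) (p≡1+2d : p ≡ suc (2 ℕ.* d)) (0<d : 0 < d) where
  open PrimeResidues pr
  open CommutativeRing residueRing
    using (_≉_; setoid; semiring; commutativeSemiring; +-group; *-congˡ; *-identityʳ; sym; trans; +-comm)
  open GroupProperties +-group using (x∙y⁻¹≈ε⇒x≈y; x≈y⇒x∙y⁻¹≈ε)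
  open Mult semiring using () renaming (_×_ to _·_)
  open Exp commutativeSemiring using (_^_; ^-congˡ; ^-assocʳ)
  open Stepanov residueRing inverse using (sumset-in-roots-of-unity)
  open import Relation.Binary.Reasoning.Setoid setoid

  -- Here d + l ≤ 2d = p - 1, and a binomial coefficient with upper index below `p` divides a
  -- factorial prime to `p`.
  C≉0 : ∀ {l} → l < suc d → ((d ℕ.+ l) C d) · 1ℤ ≉ 0ℤ
  C≉0 {l} l≤d C≈0 = prime∤C pr (ℕ.m≤m+n d l)
    (≡.subst (d ℕ.+ l <_) (≡.sym p≡1+2d) (s≤s (ℕ.+-monoʳ-≤ d (ℕ.≤-trans (ℕ.≤-pred l≤d) (ℕ.m≤m+n d 0)))))
    (≋0⇒∣ (≡.subst (_≋ 0ℤ) (n·1≡+n ((d ℕ.+ l) C d)) C≈0))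

  -- The bound with a single node gives length as ≤ d, so that the binomial coefficient
  -- in the general bound is nonzero.
  sumset-bound : ∀ {as bs} → AllPairs _≉_ as → AllPairs _≉_ bs → 0 < length as → 0 < length bs →
    (∀ {x y} → x ∈ as → y ∈ bs → (x ℤ.+ y) ^ d ≋ 1ℤ) → length bs ℕ.* length as ≤ d
  sumset-bound {as@(a ∷ as′)} {bs@(b ∷ _)} distinct distinct′ _ _ ones =
    sumset-in-roots-of-unity a as′ bs 0<d distinct distinct′
      (All.tabulate (λ y∈bs → All.tabulate (λ {x} x∈as → trans (^-congˡ d (+-comm _ x)) (ones x∈as y∈bs))))
      (C≉0 (s≤s (ℕ.<⇒≤ as≤d)))
    where
    as≤d : length as ≤ d
    as≤d = ≡.subst (_≤ d) (ℕ.*-identityʳ (length as))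
      -- With the single node `b` the polynomial is (x + b)^d - 1, and `as` are simple roots of it.
      (sumset-in-roots-of-unity b [] as 0<d ([] ∷ []) distinct
        (All.tabulate (λ x∈as → ones x∈as (here ≡.refl) ∷ [])) (C≉0 (s≤s z≤n)))

  ι : Fin p → ℤ
  ι x = + toℕ x

  ι-injective : ∀ {x y} → ι x ≋ ι y → x ≡ y
  ι-injective {x} {y} = Fin.toℕ-injective ∘ toℕ-injective-≋ (Fin.toℕ<n x) (Fin.toℕ<n y)

  ι-addF : ∀ x y → ι (addF p x y) ≋ ι x ℤ.+ ι y
  ι-addF x y = trans (≋-reflexive (≡.cong +_ (Fin.toℕ-fromℕ< _))) (+%≋+ (toℕ x ℕ.+ toℕ y))

  ι-mulF : ∀ x y → ι (mulF p x y) ≋ ι x ℤ.* ι y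
  ι-mulF x y = trans (≋-reflexive (≡.cong +_ (Fin.toℕ-fromℕ< _)))
    (trans (+%≋+ (toℕ x ℕ.* toℕ y)) (≋-reflexive (ℤ.pos-* (toℕ x) (toℕ y))))

  +≉0 : ∀ {n} → n ≢ 0 → n < p → + n ≉ 0ℤ
  +≉0 n≢0 n<p n≋0 = n≢0 (toℕ-injective-≋ n<p (ℕ.≤-<-trans z≤n n<p) n≋0)

  -- The easy half of Euler's criterion: (y²)^d = y^(p-1).
  IsQR⇒power : ∀ {x} → IsQR p x → ι x ^ d ≋ 1ℤ
  IsQR⇒power {x} (y , y≢0 , yy≡x) = begin
    ι x ^ d               ≈⟨ ^-congˡ d (≋-reflexive (≡.cong ι (≡.sym yy≡x))) ⟩
    ι (mulF p y y) ^ d    ≈⟨ ^-congˡ d (ι-mulF y y) ⟩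
    (ι y ℤ.* ι y) ^ d     ≈⟨ ^-congˡ d (*-congˡ {x = ι y} (sym (*-identityʳ (ι y)))) ⟩
    (ι y ^ 2) ^ d         ≈⟨ ^-assocʳ (ι y) 2 d ⟩
    ι y ^ (2 ℕ.* d)       ≈⟨ fermat-unit p≡1+2d (+≉0 y≢0 (Fin.toℕ<n y)) ⟩
    1ℤ                    ∎

  1+i<p : ∀ (i : Fin d) → suc (toℕ i) < p
  1+i<p i = ≡.subst (suc (toℕ i) <_) (≡.sym p≡1+2d) (s≤s (ℕ.≤-trans (Fin.toℕ<n i) (ℕ.m≤m+n d _)))

  -- The numbers 1, ..., d represent each pair ±y of nonzero classes once, so their squares are d
  -- distinct residues.
  root : Fin d → Fin p
  root i = fromℕ< (1+i<p i)

  toℕ-root : ∀ i → toℕ (root i) ≡ suc (toℕ i)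
  toℕ-root i = Fin.toℕ-fromℕ< (1+i<p i)

  square : Fin d → Fin p
  square i = mulF p (root i) (root i)

  square-IsQR : ∀ i → IsQR p (square i)
  square-IsQR i = root i , (λ eq → ℕ.1+n≢0 (≡.trans (≡.sym (toℕ-root i)) eq)) , ≡.refl

  -- Equal squares give (x - y)(x + y) = 0, and 0 < x + y ≤ 2d < p rules out the second factor.
  square-injective : ∀ {i j} → square i ≡ square j → i ≡ j
  square-injective {i} {j} eq = Fin.toℕ-injective (ℕ.suc-injective
    ([ toℕ-injective-≋ (1+i<p i) (1+i<p j) ∘ x∙y⁻¹≈ε⇒x≈y x y , (λ sum≋0 → contradiction sum≋0 (+≉0 (λ ()) sum<p)) ]′
      (domain (x ℤ.- y) (x ℤ.+ y) (begin
        (x ℤ.- y) ℤ.* (x ℤ.+ y)     ≡⟨ identity x y ⟩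
        x ℤ.* x ℤ.- y ℤ.* y
          ≈⟨ x≈y⇒x∙y⁻¹≈ε (trans (sym (ι-square i)) (trans (≋-reflexive (≡.cong ι eq)) (ι-square j))) ⟩
        0ℤ                          ∎))))
    where
    x = + suc (toℕ i)
    y = + suc (toℕ j)
    identity : ∀ x y → (x ℤ.- y) ℤ.* (x ℤ.+ y) ≡ x ℤ.* x ℤ.- y ℤ.* y
    identity = ℤ.solve-∀
    ι-square : ∀ i → ι (square i) ≋ + suc (toℕ i) ℤ.* + suc (toℕ i)
    ι-square i = trans (ι-mulF (root i) (root i)) (≋-reflexive (≡.cong (λ n → + n ℤ.* + n) (toℕ-root i)))
    sum<p : suc (toℕ i) ℕ.+ suc (toℕ j) < p
    sum<p = ≡.subst (suc (toℕ i) ℕ.+ suc (toℕ j) <_) (≡.sym p≡1+2d)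
      (s≤s (ℕ.+-mono-≤ (Fin.toℕ<n i) (ℕ.≤-trans (Fin.toℕ<n j) (ℕ.m≤m+n d 0))))

  module _ (A B : Subset p)
    (sumset : ∀ x → (InSumset p A B x → IsQR p x) × (IsQR p x → InSumset p A B x)) where

    distinct : ∀ S → AllPairs _≉_ (map ι (elements S))
    distinct S = AllPairs.map⁺ (AllPairs.map (_∘ ι-injective) (AllPairs.filter⁺ (T? ∘ Vec.lookup S) (allFin⁺ p)))

    nonempty : ∀ {S x} → x Subset.∈ S → 0 < length (map ι (elements S))
    nonempty {S} x∈S = ≡.subst (0 <_) (≡.sym (length-map ι (elements S))) (∈-length (∈⇒∈-elements S x∈S))

    elements-bound : length (elements A) ℕ.* length (elements B) ≤ d
    elements-bound =
      -- The residue 1 = 1² has a representation a + b, which shows that A and B are nonempty.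
      let _ , _ , a∈A , b∈B , _ = proj₂ (sumset (square (fromℕ< 0<d))) (square-IsQR (fromℕ< 0<d)) in
      ≡.subst₂ (λ m n → m ℕ.* n ≤ d) (length-map ι (elements A)) (length-map ι (elements B))
        -- B supplies the nodes and A the zeros, so that the product comes out in the order |A| |B|.
        (sumset-bound (distinct B) (distinct A) (nonempty b∈B) (nonempty a∈A) ones)
      where
      power : ∀ {a b} → a Subset.∈ A → b Subset.∈ B → (ι b ℤ.+ ι a) ^ d ≋ 1ℤ
      power {a} {b} a∈A b∈B = trans (^-congˡ d (trans (≋-reflexive (ℤ.+-comm (ι b) (ι a))) (sym (ι-addF a b))))
        (IsQR⇒power (proj₁ (sumset (addF p a b)) (a , b , a∈A , b∈B , ≡.refl)))
      ones : ∀ {x y} → x ∈ map ι (elements B) → y ∈ map ι (elements A) → (x ℤ.+ y) ^ d ≋ 1ℤ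
      ones x∈ y∈ =
        let _ , b∈ , x≡ιb = ∈-map⁻ ι x∈
            _ , a∈ , y≡ιa = ∈-map⁻ ι y∈
        in ≡.subst₂ (λ x y → (x ℤ.+ y) ^ d ≋ 1ℤ) (≡.sym x≡ιb) (≡.sym y≡ιa)
             (power (∈-elements⇒∈ A a∈) (∈-elements⇒∈ B b∈))

    -- All d squares have a representation, hence 2d ≤ 𝔄(A, B) + |A| |B| ≤ 𝔄(A, B) + d.
    d≤uniqueCount : d ≤ uniqueCount p A B
    d≤uniqueCount = ℕ.+-cancelʳ-≤ d d (uniqueCount p A B) (ℕ.≤-trans d+d≤2s
      (ℕ.≤-trans (support≤uniqueCount p A B) (ℕ.+-monoʳ-≤ (uniqueCount p A B) elements-bound)))
      where
      support = filterᵇ (λ x → 0 <ᵇ rep p A B x) (allFin p)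
      d≤support : d ≤ length support
      d≤support = injection⇒≤length support square square-injective λ i →
        ∈-filter⁺ (T? ∘ _) (∈-allFin (square i))
          (ℕ.<⇒<ᵇ (InSumset⇒0<rep p A B (proj₂ (sumset (square i)) (square-IsQR i))))
      d+d≤2s : d ℕ.+ d ≤ 2 ℕ.* length support
      d+d≤2s = ℕ.+-mono-≤ d≤support (ℕ.≤-trans d≤support (ℕ.m≤m+n _ 0))

-- Two elements modulo 2 fill the field, so 0 = 0 + 0 would have to be the square of a nonzero
-- element.
sumset-in-residues-mod-2 : (A B : Subset 2) → 2 ≤ ∣ A ∣ → 2 ≤ ∣ B ∣ → ¬ (∀ x → InSumset 2 A B x → IsQR 2 x)
sumset-in-residues-mod-2 (true Vec.∷ true Vec.∷ Vec.[]) (true Vec.∷ true Vec.∷ Vec.[]) _ _ h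
  with h Fin.zero (Fin.zero , Fin.zero , Vec.here , Vec.here , ≡.refl)
... | Fin.zero , y≢0 , _ = y≢0 ≡.refl
... | Fin.suc Fin.zero , _ , ()
sumset-in-residues-mod-2 (true  Vec.∷ false Vec.∷ Vec.[]) _ (s≤s ())
sumset-in-residues-mod-2 (false Vec.∷ true  Vec.∷ Vec.[]) _ (s≤s ())
sumset-in-residues-mod-2 (false Vec.∷ false Vec.∷ Vec.[]) _ ()
sumset-in-residues-mod-2 _ (true  Vec.∷ false Vec.∷ Vec.[]) _ (s≤s ())
sumset-in-residues-mod-2 _ (false Vec.∷ true  Vec.∷ Vec.[]) _ (s≤s ())
sumset-in-residues-mod-2 _ (false Vec.∷ false Vec.∷ Vec.[]) _ ()

theorem1p2 : (p : ℕ) .{{_ : NonZero p}} → Prime p →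
    (A B : Subset p) → 2 ≤ ∣ A ∣ → 2 ≤ ∣ B ∣ →
    (∀ (x : Fin p) → (InSumset p A B x → IsQR p x) × (IsQR p x → InSumset p A B x)) →
    SqrtLeLn2Bound p (uniqueCount p A B)
theorem1p2 p pr A B 2≤∣A∣ 2≤∣B∣ sumset = sqrtLeLn2Bound p N
  (≡.subst (_≤ 2 ℕ.* N ℕ.+ 1) (≡.trans (ℕ.+-comm (2 ℕ.* d) 1) (≡.sym p≡1+2d))
    (ℕ.+-monoˡ-≤ 1 (ℕ.*-monoʳ-≤ 2 (QuadraticResidues.d≤uniqueCount pr p≡1+2d 0<d A B sumset))))
  where
  N = uniqueCount p A B
  p≢2 : p ≢ 2
  p≢2 ≡.refl = sumset-in-residues-mod-2 A B 2≤∣A∣ 2≤∣B∣ (λ x → proj₁ (sumset x))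
  odd = odd-prime pr p≢2
  d = proj₁ odd
  0<d = proj₁ (proj₂ odd)
  p≡1+2d = proj₂ (proj₂ odd)
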